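{- Let $k$ and $n$ be two nonnegative integers with $n\equiv k \pmod 2$, and let $\theta(n,k)$ be the largest root of the equation $$x^{3}-(n-4)x^{2}-(n+2k-1)x+2(k+1)(n-k-4)=0.$$ Then the following hold. (1) If either $n\geq k+4$ and $n\notin\{k+6,k+8\}$, or $(k,n)=(0,8)$, then $\rho(K_{n-k-3}\vee K_{k+1}\vee(2K_1))=\theta(n,k)$ and the graph $K_{n-k-3}\vee K_{k+1}\vee(2K_1)$ is not $k$-factor-critical. (2) If $n=k+6$, then $\rho(K_{k+2}\vee(4K_1))=\frac{k+1+\sqrt{k^{2}+18k+33}}{2}$ and the graph $K_{k+2}\vee(4K_1)$ is not $k$-factor-critical. (3) If $n=k+8$, then $\rho(K_{k+3}\vee(5K_1))=\frac{k+2+\sqrt{k^{2}+24k+64}}{2}$ and the graph $K_{k+3}\vee(5K_1)$ is not $k$-factor-critical.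
   Context: All graphs are finite and simple (no loops, no multiple edges). The spectral radius $\rho(G)$ is the largest eigenvalue of the (0,1)-adjacency matrix $A(G)$ of $G$. $K_m$ is the complete graph on $m$ vertices, and $mK_1$ is the graph consisting of $m$ isolated vertices. For vertex-disjoint graphs $G_1,\dots,G_r$ ($r\geq2$), the sequential join $G_1\vee G_2\vee\cdots\vee G_r$ is the graph with vertex set $V(G_1)\cup\cdots\cup V(G_r)$ whose edges are all edges of each $G_i$ together with all pairs $uv$ with $u\in V(G_i)$ and $v\in V(G_{i+1})$ for some $1\leq i\leq r-1$. In particular, only consecutive graphs are joined: in $G_1\vee G_2\vee G_3$ there are no edges between $V(G_1)$ and $V(G_3)$. For $Q\subseteq V(G)$, $G-Q$ is the graph obtained from $G$ by removing the vertices in $Q$ and their incident edges. A perfect matching (1-factor) of a graph is a spanning subgraph in which every vertex has degree exactly 1. For a nonnegative integer $k$, a graph $G$ is $k$-factor-critical if $G-Q$ has a perfect matching for every $Q\subseteq V(G)$ with $|Q|=k$. -}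

module Defs where

open import Algebra.Bundles.Raw using (RawRing)
import Algebra.Definitions.RawSemiring as RawSemiringDefs
open import Data.Bool.Base using (Bool; true; false; not; if_then_else_)
open import Data.Fin.Base using (Fin; splitAt)
import Data.Fin.Properties as Fin
open import Data.Fin.Subset using (Subset; _∈_; ∁; ∣_∣)
open import Data.Integer.Base as ℤ using (ℤ; +_)
open import Data.List.Base using ([]; _∷_)
open import Data.List.Relation.Unary.All using (All; []; _∷_)
open import Data.Nat.ListAction using (sum)
open import Data.Nat.Base as ℕ using (ℕ)
import Data.Nat.Properties as ℕ
open import Data.Product using (Σ-syntax; ∃-syntax; ∃!; _×_; _,_; proj₁)
open import Data.Rational.Base as ℚ using (ℚ; 0ℚ; 1ℚ; ½)
import Data.Rational.Properties as ℚ
open import Data.Rational.Solver using (module +-*-Solver)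
open import Data.Sum.Base using (_⊎_; inj₁; inj₂; [_,_]′)
open import Function.Base using (_∘_; const)
open import Function.Bundles using (mk⇔)
open import Level using (0ℓ)
open import Relation.Binary.PropositionalEquality
open import Relation.Nullary.Decidable using (does; dec-true; does-⇔)

------------------------------------------------------------------------
-- Real numbers: Cauchy sequences of rationals, with equality _≃_ meaning
-- that the difference is a null sequence.

Cauchy : (ℕ → ℚ) → Set
Cauchy s = ∀ ε → 0ℚ ℚ.< ε →
  ∃[ N ] ∀ m n → N ℕ.≤ m → N ℕ.≤ n → ℚ.∣ s m ℚ.- s n ∣ ℚ.< ε

record ℝ : Set where
  constructor mkℝ
  field
    seq    : ℕ → ℚ
    cauchy : Cauchy seq

open ℝ public

private
  open +-*-Solver

  0<½* : ∀ {ε} → 0ℚ ℚ.< ε → 0ℚ ℚ.< ½ ℚ.* ε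
  0<½* {ε} 0<ε = subst (ℚ._< ½ ℚ.* ε) (ℚ.*-zeroʳ ½) (ℚ.*-monoʳ-<-pos ½ 0<ε)

  +-small : ∀ p q ε → ℚ.∣ p ∣ ℚ.< ½ ℚ.* ε → ℚ.∣ q ∣ ℚ.< ½ ℚ.* ε → ℚ.∣ p ℚ.+ q ∣ ℚ.< ε
  +-small p q ε hp hq = ℚ.≤-<-trans (ℚ.∣p+q∣≤∣p∣+∣q∣ p q)
    (subst (ℚ.∣ p ∣ ℚ.+ ℚ.∣ q ∣ ℚ.<_)
      (solve 1 (λ e → con ½ :* e :+ con ½ :* e := e) refl ε)
      (ℚ.+-mono-< {ℚ.∣ p ∣} {½ ℚ.* ε} {ℚ.∣ q ∣} {½ ℚ.* ε} hp hq))

  const-cauchy : ∀ q → Cauchy (const q)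
  const-cauchy q ε 0<ε =
    0 , λ _ _ _ _ → subst (λ d → ℚ.∣ d ∣ ℚ.< ε) (sym (ℚ.+-inverseʳ q)) 0<ε

  neg-cauchy : ∀ s → Cauchy s → Cauchy (λ n → ℚ.- s n)
  neg-cauchy s cs ε 0<ε with cs ε 0<ε
  ... | N , h = N , λ m n N≤m N≤n → subst (ℚ._< ε) (eq (s m) (s n)) (h m n N≤m N≤n)
    where
    eq : ∀ a b → ℚ.∣ a ℚ.- b ∣ ≡ ℚ.∣ ℚ.- a ℚ.- ℚ.- b ∣
    eq a b = trans (sym (ℚ.∣-p∣≡∣p∣ (a ℚ.- b)))
      (cong ℚ.∣_∣ (solve 2 (λ x y → :- (x :- y) := :- x :- (:- y)) refl a b))

  +-cauchy : ∀ s t → Cauchy s → Cauchy t → Cauchy (λ n → s n ℚ.+ t n)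
  +-cauchy s t cs ct ε 0<ε with cs (½ ℚ.* ε) (0<½* 0<ε) | ct (½ ℚ.* ε) (0<½* 0<ε)
  ... | M , f | N , g = M ℕ.⊔ N , λ m n p q →
    subst (λ d → ℚ.∣ d ∣ ℚ.< ε)
      (solve 4 (λ a b c d → (a :- c) :+ (b :- d) := (a :+ b) :- (c :+ d))
        refl (s m) (t m) (s n) (t n))
      (+-small (s m ℚ.- s n) (t m ℚ.- t n) ε
        (f m n (ℕ.m⊔n≤o⇒m≤o M N p) (ℕ.m⊔n≤o⇒m≤o M N q))
        (g m n (ℕ.m⊔n≤o⇒n≤o M N p) (ℕ.m⊔n≤o⇒n≤o M N q)))

  bounded : ∀ s → Cauchy s →
    ∃[ B ] (0ℚ ℚ.< B × ∃[ N ] ∀ m → N ℕ.≤ m → ℚ.∣ s m ∣ ℚ.≤ B)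
  bounded s cs with cs 1ℚ (ℚ.positive⁻¹ 1ℚ)
  ... | N , h = B , 0<B , N , λ m N≤m → begin
    ℚ.∣ s m ∣
      ≡⟨ cong ℚ.∣_∣ (solve 2 (λ a b → a := (a :- b) :+ b) refl (s m) (s N)) ⟩
    ℚ.∣ (s m ℚ.- s N) ℚ.+ s N ∣
      ≤⟨ ℚ.∣p+q∣≤∣p∣+∣q∣ (s m ℚ.- s N) (s N) ⟩
    ℚ.∣ s m ℚ.- s N ∣ ℚ.+ ℚ.∣ s N ∣
      ≤⟨ ℚ.+-monoˡ-≤ ℚ.∣ s N ∣ (ℚ.<⇒≤ (h m N N≤m ℕ.≤-refl)) ⟩
    B ∎
    where
    open ℚ.≤-Reasoning
    B : ℚ
    B = 1ℚ ℚ.+ ℚ.∣ s N ∣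
    0<B : 0ℚ ℚ.< B
    0<B = ℚ.+-mono-<-≤ (ℚ.positive⁻¹ 1ℚ) (ℚ.0≤∣p∣ (s N))

  *-small : ∀ {B δ} → 0ℚ ℚ.< B → ∀ a d → ℚ.∣ a ∣ ℚ.≤ B → ℚ.∣ d ∣ ℚ.< δ →
    ℚ.∣ a ℚ.* d ∣ ℚ.< B ℚ.* δ
  *-small {B} {δ} 0<B a d a≤B d<δ = subst (ℚ._< B ℚ.* δ) (sym (ℚ.∣p*q∣≡∣p∣*∣q∣ a d))
    (ℚ.≤-<-trans {_} {B ℚ.* ℚ.∣ d ∣}
      (ℚ.*-monoʳ-≤-nonNeg ℚ.∣ d ∣ {{ℚ.∣-∣-nonNeg d}} {ℚ.∣ a ∣} {B} a≤B)
      (ℚ.*-monoʳ-<-pos B {{ℚ.positive 0<B}} {ℚ.∣ d ∣} {δ} d<δ))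

  scale : ∀ {B ε} → 0ℚ ℚ.< B → 0ℚ ℚ.< ε → ∃[ δ ] (0ℚ ℚ.< δ ×
    (∀ a d → ℚ.∣ a ∣ ℚ.≤ B → ℚ.∣ d ∣ ℚ.< δ → ℚ.∣ a ℚ.* d ∣ ℚ.< ε))
  scale {B} {ε} 0<B 0<ε = δ , 0<δ , λ a d a≤B d<δ →
    subst (ℚ.∣ a ℚ.* d ∣ ℚ.<_) Bδ (*-small {B} {δ} 0<B a d a≤B d<δ)
    where
    instance
      B-pos : ℚ.Positive B
      B-pos = ℚ.positive 0<B
      B-nonZero : ℚ.NonZero B
      B-nonZero = ℚ.pos⇒nonZero B
    δ : ℚ
    δ = ℚ.1/ B ℚ.* ε
    0<δ : 0ℚ ℚ.< δ
    0<δ = subst (ℚ._< δ) (ℚ.*-zeroʳ (ℚ.1/ B))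
      (ℚ.*-monoʳ-<-pos (ℚ.1/ B) {{ℚ.1/pos⇒pos B}} 0<ε)
    Bδ : B ℚ.* δ ≡ ε
    Bδ = trans (sym (ℚ.*-assoc B (ℚ.1/ B) ε))
      (trans (cong (ℚ._* ε) (ℚ.*-inverseʳ B)) (ℚ.*-identityˡ ε))

  *-diff : ∀ a b c d → a ℚ.* (b ℚ.- d) ℚ.+ d ℚ.* (a ℚ.- c) ≡ a ℚ.* b ℚ.- c ℚ.* d
  *-diff = solve 4 (λ a b c d → a :* (b :- d) :+ d :* (a :- c) := a :* b :- c :* d) refl

  *-cauchy : ∀ s t → Cauchy s → Cauchy t → Cauchy (λ n → s n ℚ.* t n)
  *-cauchy s t cs ct ε 0<ε =
    let S , 0<S , Nₛ , s≤S  = bounded s cs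
        T , 0<T , Nₜ , t≤T  = bounded t ct
        δ , 0<δ , s-small   = scale {S} {½ ℚ.* ε} 0<S (0<½* 0<ε)
        η , 0<η , t-small   = scale {T} {½ ℚ.* ε} 0<T (0<½* 0<ε)
        M , f               = ct δ 0<δ
        N , g               = cs η 0<η
    in (Nₛ ℕ.⊔ Nₜ) ℕ.⊔ (M ℕ.⊔ N) , λ m n p q →
    let p₁ = ℕ.m⊔n≤o⇒m≤o (Nₛ ℕ.⊔ Nₜ) (M ℕ.⊔ N) p
        p₂ = ℕ.m⊔n≤o⇒n≤o (Nₛ ℕ.⊔ Nₜ) (M ℕ.⊔ N) p
        q₁ = ℕ.m⊔n≤o⇒m≤o (Nₛ ℕ.⊔ Nₜ) (M ℕ.⊔ N) q
        q₂ = ℕ.m⊔n≤o⇒n≤o (Nₛ ℕ.⊔ Nₜ) (M ℕ.⊔ N) q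
    in subst (λ d → ℚ.∣ d ∣ ℚ.< ε) (*-diff (s m) (t m) (s n) (t n))
      (+-small (s m ℚ.* (t m ℚ.- t n)) (t n ℚ.* (s m ℚ.- s n)) ε
        (s-small (s m) (t m ℚ.- t n) (s≤S m (ℕ.m⊔n≤o⇒m≤o Nₛ Nₜ p₁))
          (f m n (ℕ.m⊔n≤o⇒m≤o M N p₂) (ℕ.m⊔n≤o⇒m≤o M N q₂)))
        (t-small (t n) (s m ℚ.- s n) (t≤T n (ℕ.m⊔n≤o⇒n≤o Nₛ Nₜ q₁))
          (g m n (ℕ.m⊔n≤o⇒n≤o M N p₂) (ℕ.m⊔n≤o⇒n≤o M N q₂))))

infix  4 _≃_ _≤_ _<_ _#_
infixl 6 _+_ _-_
infixl 7 _*_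
infix  8 -_

_≃_ _≤_ _<_ _#_ : ℝ → ℝ → Set
x ≃ y = ∀ ε → 0ℚ ℚ.< ε → ∃[ N ] ∀ n → N ℕ.≤ n → ℚ.∣ seq x n ℚ.- seq y n ∣ ℚ.< ε
x ≤ y = ∀ ε → 0ℚ ℚ.< ε → ∃[ N ] ∀ n → N ℕ.≤ n → seq x n ℚ.< seq y n ℚ.+ ε
x < y = ∃[ ε ] (0ℚ ℚ.< ε × ∃[ N ] ∀ n → N ℕ.≤ n → seq x n ℚ.+ ε ℚ.< seq y n)
x # y = x < y ⊎ y < x

fromℚ : ℚ → ℝ
fromℚ q = mkℝ (const q) (const-cauchy q)

fromℤ : ℤ → ℝ
fromℤ z = fromℚ (z ℚ./ 1)

fromℕ : ℕ → ℝ
fromℕ n = fromℤ (+ n)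

0ℝ 1ℝ : ℝ
0ℝ = fromℚ 0ℚ
1ℝ = fromℚ 1ℚ

-_ : ℝ → ℝ
- x = mkℝ (λ n → ℚ.- seq x n) (neg-cauchy (seq x) (cauchy x))

_+_ _-_ _*_ : ℝ → ℝ → ℝ
x + y = mkℝ (λ n → seq x n ℚ.+ seq y n) (+-cauchy (seq x) (seq y) (cauchy x) (cauchy y))
x - y = x + (- y)
x * y = mkℝ (λ n → seq x n ℚ.* seq y n) (*-cauchy (seq x) (seq y) (cauchy x) (cauchy y))

ℝ-rawRing : RawRing 0ℓ 0ℓ
ℝ-rawRing = record
  { Carrier = ℝ ; _≈_ = _≃_ ; _+_ = _+_ ; _*_ = _*_ ; -_ = -_ ; 0# = 0ℝ ; 1# = 1ℝ }

open RawSemiringDefs (RawRing.rawSemiring ℝ-rawRing) public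
  using (_^_) renaming (sum to ∑)

IsSqrt : ℝ → ℝ → Set
IsSqrt a s = 0ℝ ≤ s × s * s ≃ a

IsGreatest : (ℝ → Set) → ℝ → Set
IsGreatest P x = P x × (∀ y → P y → y ≤ x)

------------------------------------------------------------------------
-- Eigenvalues.  A vector is nonzero when some entry is apart from 0.

Matrix : ℕ → Set
Matrix n = Fin n → Fin n → ℝ

IsEigenvalue : ∀ {n} → Matrix n → ℝ → Set
IsEigenvalue {n} A μ = Σ[ v ∈ (Fin n → ℝ) ] (∃[ i ] v i # 0ℝ)
  × (∀ i → ∑ (λ j → A i j * v j) ≃ μ * v i)

------------------------------------------------------------------------
-- Simple graphs on a vertex type V.  A finite graph of order n is a
-- Graph (Fin n); other vertex types occur for disjoint unions and for
-- vertex-deleted subgraphs.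

record Graph (V : Set) : Set where
  field
    adj    : V → V → Bool
    symm   : ∀ u v → adj u v ≡ adj v u
    irrefl : ∀ v → adj v v ≡ false

open Graph public

pullback : ∀ {V W} → (W → V) → Graph V → Graph W
pullback f G = record
  { adj    = λ u v → adj G (f u) (f v)
  ; symm   = λ u v → symm G (f u) (f v)
  ; irrefl = λ v → irrefl G (f v)
  }

K : ∀ m → Graph (Fin m)
K m = record
  { adj    = λ u v → not (does (u Fin.≟ v))
  ; symm   = λ u v → cong not (does-⇔ (mk⇔ sym sym) (u Fin.≟ v) (v Fin.≟ u))
  ; irrefl = λ v → cong not (dec-true (v Fin.≟ v) refl)
  }

_K₁ : ∀ m → Graph (Fin m)
m K₁ = record
  { adj    = λ _ _ → false
  ; symm   = λ _ _ → refl
  ; irrefl = λ _ → refl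
  }

-- Disjoint union of G and H, with in addition every vertex of G adjacent to
-- the vertices of H selected by p.
glue : ∀ {V W} → Graph V → Graph W → (W → Bool) → Graph (V ⊎ W)
glue {V} {W} G H p = record { adj = a ; symm = s ; irrefl = i }
  where
  a : V ⊎ W → V ⊎ W → Bool
  a (inj₁ u) (inj₁ v) = adj G u v
  a (inj₁ u) (inj₂ w) = p w
  a (inj₂ w) (inj₁ u) = p w
  a (inj₂ w) (inj₂ z) = adj H w z
  s : ∀ x y → a x y ≡ a y x
  s (inj₁ u) (inj₁ v) = symm G u v
  s (inj₁ u) (inj₂ w) = refl
  s (inj₂ w) (inj₁ u) = refl
  s (inj₂ w) (inj₂ z) = symm H w z
  i : ∀ x → a x x ≡ false
  i (inj₁ u) = irrefl G u
  i (inj₂ w) = irrefl H w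

-- Sequential join.  The vertices of the listed graphs are numbered
-- consecutively; splitAt n separates those of the first graph from the rest.
inFirst : ∀ ns → Fin (sum ns) → Bool
inFirst (n ∷ ns) v = [ const true , const false ]′ (splitAt n v)

⋁ : ∀ {ns} → All (Graph ∘ Fin) ns → Graph (Fin (sum ns))
⋁ []                  = 0 K₁
⋁ (_∷_ {n} {ns} G Gs) = pullback (splitAt n) (glue G (⋁ Gs) (inFirst ns))

adjacencyMatrix : ∀ {n} → Graph (Fin n) → Matrix n
adjacencyMatrix G i j = if adj G i j then 1ℝ else 0ℝ

IsSpectralRadius : ∀ {n} → Graph (Fin n) → ℝ → Set
IsSpectralRadius G = IsGreatest (IsEigenvalue (adjacencyMatrix G))

-- _∈ ∁ Q is used instead of _∉ Q so that a vertex of G ∖ Q is determined by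
-- the underlying vertex of G.
_∖_ : ∀ {n} → Graph (Fin n) → (Q : Subset n) → Graph (∃[ v ] v ∈ ∁ Q)
G ∖ Q = pullback proj₁ G

record PerfectMatching {V : Set} (G : Graph V) : Set where
  field
    matching : Graph V
    spanning : ∀ u v → adj matching u v ≡ true → adj G u v ≡ true
    degree-1 : ∀ v → ∃! _≡_ (λ w → adj matching v w ≡ true)

IsFactorCritical : ∀ {n} → ℕ → Graph (Fin n) → Set
IsFactorCritical {n} k G = (Q : Subset n) → ∣ Q ∣ ≡ k → PerfectMatching (G ∖ Q)

------------------------------------------------------------------------

cubic : (n k : ℕ) → ℝ → ℝ
cubic n k x =
    x ^ 3
  - fromℤ (+ n ℤ.- + 4) * x ^ 2
  - fromℤ (+ n ℤ.+ + 2 ℤ.* + k ℤ.- + 1) * x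
  + fromℤ (+ 2 ℤ.* (+ k ℤ.+ + 1) ℤ.* (+ n ℤ.- + k ℤ.- + 4))

-- Largest elements are unique up to _≃_, so θ(n,k) is rendered by this
-- predicate, as is ρ(G) by IsSpectralRadius G.
IsLargestRoot : (n k : ℕ) → ℝ → Set
IsLargestRoot n k = IsGreatest (λ x → cubic n k x ≃ 0ℝ)

{-# OPTIONS --safe #-}
-- A positive vector w with A w = θ w bounds every eigenvalue μ by θ: if A v = μ v then μ ∣v∣ ≤ A ∣v∣,
-- and pairing with w gives μ ⟨w,∣v∣⟩ ≤ ⟨A w,∣v∣⟩ = θ ⟨w,∣v∣⟩ with ⟨w,∣v∣⟩ > 0.  For a sequential join
-- of complete and empty graphs such a w is constant on the blocks, so it exists as soon as θ is a
-- large enough root of the characteristic polynomial of the quotient matrix.  Roots are constructed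
-- by bisection.  A larger root of the cubic would again be an eigenvalue, hence θ is its largest root.
-- For the failure of k-factor-criticality, delete k vertices of the clique joined to the c isolated
-- vertices: fewer than c of its vertices remain, and they are the only possible partners.
module Submission where

open import Algebra.Bundles using (CommutativeRing)
import Algebra.Properties.Semiring.Sum as SemiringSum
import Algebra.Solver.Ring as RingSolver
open import Algebra.Solver.Ring.AlmostCommutativeRing using (fromCommutativeRing; _-Raw-AlmostCommutative⟶_)
open import Data.Bool.Base using (Bool; true; false; if_then_else_)
open import Data.Fin.Base using (Fin; zero; suc; splitAt; _↑ˡ_; _↑ʳ_)
import Data.Fin.Properties as Fin
open import Data.Integer.Base as ℤ using (+_; -[1+_])
import Data.Integer.Properties as ℤ
open import Data.List.Base using ([]; _∷_)
open import Data.List.Relation.Unary.All using (All; []; _∷_)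
open import Data.Maybe.Base using (Maybe; map)
open import Data.Nat.Base as ℕ using (ℕ; zero; suc; _∸_; _%_)
open import Data.Nat.ListAction using () renaming (sum to sumℕ)
import Data.Nat.Properties as ℕ
open import Data.Nat.Solver using () renaming (module +-*-Solver to ℕS)
open import Data.Product using (∃-syntax; _×_; _,_; proj₁; proj₂)
open import Data.Rational.Base as ℚ using (ℚ; 0ℚ; 1ℚ; ½)
import Data.Rational.Properties as ℚ
open import Data.Rational.Solver using (module +-*-Solver)
import Data.Rational.Unnormalised.Base as ℚᵘ
import Data.Rational.Unnormalised.Properties as ℚᵘ
open import Data.Sum.Base using (_⊎_; inj₁; inj₂; [_,_]′; map₁)
open import Function.Base using (_∘_; const)
open import Level using (0ℓ)
open import Relation.Binary.Bundles using (Preorder)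
open import Relation.Binary.PropositionalEquality using (_≡_; _≢_; refl; sym; trans; cong; cong₂; subst; subst₂)
import Relation.Binary.Reasoning.Preorder as PreorderReasoning
import Relation.Binary.Reasoning.Setoid as SetoidReasoning
open import Relation.Nullary.Decidable using (Dec; yes; no; dec⇒maybe; from-yes)
open import Relation.Nullary.Negation using (¬_; contradiction)
import Defs as D

-- The order on these Cauchy reals is undecidable, so neither the sign of an eigenvalue nor the
-- comparison of two roots is ever settled by cases. Signs of μ are avoided through μ∣y∣ ≤ ∣μy∣, and
-- "no root exceeds θ" is proved by refuting θ < y, which suffices because ≤ is stable under double
-- negation. The cubic is the characteristic polynomial of the quotient matrix with rows (a-1, b,
-- 0), (a, b-1, 2), (0, b, 0), where a = n-k-3 and b = k+1 are the clique sizes. "Large enough"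
-- means θ ≥ a: the weights contain the factor θ-(a-1), which is then at least 1. This is why the
-- root is sought in the interval from a to n. The cubic is negative at a, which needs b ≥ 1, and
-- positive at n. The two square-root values solve the analogous quadratic x² = (b-1)x + cb for a
-- clique of size b joined to c isolated vertices.

module Reals where

  open import Defs hiding (_+_; _*_; -_; _-_)
  open +-*-Solver using (solve; _:=_; _:+_; _:*_; _:-_; :-_; con)

  -- A substitute for linear arithmetic: inequalities with the same difference of sides are
  -- interchangeable, and the equality of differences is a ring identity left to `solve`.
  <-shift : ∀ {a b c d} → a ℚ.< b → b ℚ.- a ≡ d ℚ.- c → c ℚ.< d
  <-shift {a} {b} {c} {d} a<b eq = subst₂ ℚ._<_
    (solve 2 (λ a c → (c :- a) :+ a := c) refl a c)
    (trans (solve 3 (λ a b c → (c :- a) :+ b := (b :- a) :+ c) refl a b c)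
      (trans (cong (ℚ._+ c) eq) (solve 2 (λ c d → (d :- c) :+ c := d) refl c d)))
    (ℚ.+-monoʳ-< (c ℚ.- a) a<b)

  ≤-shift : ∀ {a b c d} → a ℚ.≤ b → b ℚ.- a ≡ d ℚ.- c → c ℚ.≤ d
  ≤-shift {a} {b} {c} {d} a≤b eq = subst₂ ℚ._≤_
    (solve 2 (λ a c → (c :- a) :+ a := c) refl a c)
    (trans (solve 3 (λ a b c → (c :- a) :+ b := (b :- a) :+ c) refl a b c)
      (trans (cong (ℚ._+ c) eq) (solve 2 (λ c d → (d :- c) :+ c := d) refl c d)))
    (ℚ.+-monoʳ-≤ (c ℚ.- a) a≤b)

  p≤∣p∣ : ∀ p → p ℚ.≤ ℚ.∣ p ∣
  p≤∣p∣ p with ℚ.≤-total 0ℚ p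
  ... | inj₁ 0≤p = ℚ.≤-reflexive (sym (ℚ.0≤p⇒∣p∣≡p 0≤p))
  ... | inj₂ p≤0 = ℚ.≤-trans p≤0 (ℚ.0≤∣p∣ p)

  -p≤∣p∣ : ∀ p → ℚ.- p ℚ.≤ ℚ.∣ p ∣
  -p≤∣p∣ p = subst (ℚ.- p ℚ.≤_) (ℚ.∣-p∣≡∣p∣ p) (p≤∣p∣ (ℚ.- p))

  ∣p∣<q : ∀ {p q} → p ℚ.< q → ℚ.- p ℚ.< q → ℚ.∣ p ∣ ℚ.< q
  ∣p∣<q {p} {q} p<q -p<q with ℚ.∣p∣≡p∨∣p∣≡-p p
  ... | inj₁ eq = subst (ℚ._< q) (sym eq) p<q
  ... | inj₂ eq = subst (ℚ._< q) (sym eq) -p<q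

  ∣∣p∣-∣q∣∣≤∣p-q∣ : ∀ p q → ℚ.∣ ℚ.∣ p ∣ ℚ.- ℚ.∣ q ∣ ∣ ℚ.≤ ℚ.∣ p ℚ.- q ∣
  ∣∣p∣-∣q∣∣≤∣p-q∣ p q with ℚ.∣p∣≡p∨∣p∣≡-p (ℚ.∣ p ∣ ℚ.- ℚ.∣ q ∣)
  ... | inj₁ eq = subst (ℚ._≤ ℚ.∣ p ℚ.- q ∣) (sym eq) (≤-shift
    (ℚ.∣p+q∣≤∣p∣+∣q∣ (p ℚ.- q) q)
    (trans (cong (λ d → ℚ.∣ p ℚ.- q ∣ ℚ.+ ℚ.∣ q ∣ ℚ.- ℚ.∣ d ∣)
             (solve 2 (λ p q → (p :- q) :+ q := p) refl p q))
      (solve 3 (λ a b c → a :+ b :- c := a :- (c :- b)) refl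
        (ℚ.∣ p ℚ.- q ∣) (ℚ.∣ q ∣) (ℚ.∣ p ∣))))
  ... | inj₂ eq = subst₂ ℚ._≤_ (sym eq)
    (trans (sym (ℚ.∣-p∣≡∣p∣ (q ℚ.- p)))
      (cong ℚ.∣_∣ (solve 2 (λ p q → :- (q :- p) := p :- q) refl p q)))
    (≤-shift
      (ℚ.∣p+q∣≤∣p∣+∣q∣ (q ℚ.- p) p)
      (trans (cong (λ d → ℚ.∣ q ℚ.- p ∣ ℚ.+ ℚ.∣ p ∣ ℚ.- ℚ.∣ d ∣)
               (solve 2 (λ p q → (p :- q) :+ q := p) refl q p))
        (solve 3 (λ a b c → a :+ b :- c := a :- (:- (b :- c))) refl
          (ℚ.∣ q ℚ.- p ∣) (ℚ.∣ p ∣) (ℚ.∣ q ∣))))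

  0<½ε : ∀ {ε} → 0ℚ ℚ.< ε → 0ℚ ℚ.< ½ ℚ.* ε
  0<½ε {ε} 0<ε = subst (ℚ._< ½ ℚ.* ε) (ℚ.*-zeroʳ ½) (ℚ.*-monoʳ-<-pos ½ 0<ε)

  ½+½ : ∀ ε → ½ ℚ.* ε ℚ.+ ½ ℚ.* ε ≡ ε
  ½+½ = solve 1 (λ e → con ½ :* e :+ con ½ :* e := e) refl

  *-pos : ∀ {p q} → 0ℚ ℚ.< p → 0ℚ ℚ.< q → 0ℚ ℚ.< p ℚ.* q
  *-pos {p} {q} 0<p 0<q = subst (ℚ._< p ℚ.* q) (ℚ.*-zeroʳ p) (ℚ.*-monoʳ-<-pos p {{ℚ.positive 0<p}} 0<q)

  *-nonneg : ∀ {p q} → 0ℚ ℚ.≤ p → 0ℚ ℚ.≤ q → 0ℚ ℚ.≤ p ℚ.* q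
  *-nonneg {p} {q} 0≤p 0≤q = subst (ℚ._≤ p ℚ.* q) (ℚ.*-zeroʳ p) (ℚ.*-monoˡ-≤-nonNeg p {{ℚ.nonNegative 0≤p}} 0≤q)

  -- Abstract, as are the bounds below: comparing unfolded quotients of rationals makes Agda run gcd symbolically.
  abstract
    divide : ∀ {B} → 0ℚ ℚ.< B → ∀ q → ∃[ δ ] B ℚ.* δ ≡ q
    divide {B} 0<B q = ℚ.1/ B ℚ.* q ,
      trans (sym (ℚ.*-assoc B (ℚ.1/ B) q)) (trans (cong (ℚ._* q) (ℚ.*-inverseʳ B)) (ℚ.*-identityˡ q))
      where
      instance
        B-nonZero : ℚ.NonZero B
        B-nonZero = ℚ.pos⇒nonZero B {{ℚ.positive 0<B}}

    quotient : ∀ {B ε} → 0ℚ ℚ.< B → 0ℚ ℚ.< ε → ∃[ δ ] (0ℚ ℚ.< δ × B ℚ.* δ ≡ ε)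
    quotient {B} {ε} 0<B 0<ε = let δ , Bδ = divide 0<B ε in δ ,
      ℚ.*-cancelˡ-<-nonNeg B {{ℚ.nonNegative (ℚ.<⇒≤ 0<B)}} (subst₂ ℚ._<_ (sym (ℚ.*-zeroʳ B)) (sym Bδ) 0<ε) , Bδ

  ∣p*q∣<B*C : ∀ p q B C → ℚ.∣ p ∣ ℚ.< B → ℚ.∣ q ∣ ℚ.< C → ℚ.∣ p ℚ.* q ∣ ℚ.< B ℚ.* C
  ∣p*q∣<B*C p q B C p<B q<C = subst (ℚ._< B ℚ.* C) (sym (ℚ.∣p*q∣≡∣p∣*∣q∣ p q))
    (ℚ.≤-<-trans
      (ℚ.*-monoˡ-≤-nonNeg ℚ.∣ p ∣ {{ℚ.∣-∣-nonNeg p}} (ℚ.<⇒≤ q<C))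
      (ℚ.*-monoˡ-<-pos C {{ℚ.positive (ℚ.≤-<-trans (ℚ.0≤∣p∣ q) q<C)}} p<B))

  -- The commutative ring of Cauchy reals

  Eventually : (ℕ → Set) → Set
  Eventually P = ∃[ N ] ∀ n → N ℕ.≤ n → P n

  module _ {P Q : ℕ → Set} where

    ev-map : (∀ n → P n → Q n) → Eventually P → Eventually Q
    ev-map f (N , h) = N , λ n N≤n → f n (h n N≤n)

    ev-zip : Eventually P → Eventually Q → Eventually (λ n → P n × Q n)
    ev-zip (M , g) (N , h) = M ℕ.⊔ N , λ n p → g n (ℕ.m⊔n≤o⇒m≤o M N p) , h n (ℕ.m⊔n≤o⇒n≤o M N p)

  abstract
    bounded : ∀ x → ∃[ B ] (0ℚ ℚ.< B × Eventually (λ n → ℚ.∣ seq x n ∣ ℚ.< B))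
    bounded x with cauchy x 1ℚ (ℚ.positive⁻¹ 1ℚ)
    ... | N , h = 1ℚ ℚ.+ ℚ.∣ seq x N ∣ , ℚ.+-mono-<-≤ (ℚ.positive⁻¹ 1ℚ) (ℚ.0≤∣p∣ (seq x N)) , N , λ n N≤n →
      ℚ.≤-<-trans
        (subst (λ d → ℚ.∣ d ∣ ℚ.≤ ℚ.∣ seq x n ℚ.- seq x N ∣ ℚ.+ ℚ.∣ seq x N ∣)
          (solve 2 (λ a b → (a :- b) :+ b := a) refl (seq x n) (seq x N))
          (ℚ.∣p+q∣≤∣p∣+∣q∣ (seq x n ℚ.- seq x N) (seq x N)))
        (ℚ.+-monoˡ-< ℚ.∣ seq x N ∣ (h n N N≤n ℕ.≤-refl))

  -- _≃_, _≤_ and _<_ unfold to function types from which Agda cannot infer the two reals;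
  -- these wrappers restore that inference.
  infix 4 _≈_ _≼_ _≺_

  record _≈_ (x y : ℝ) : Set where
    constructor ⟪_⟫
    field get : x ≃ y

  record _≼_ (x y : ℝ) : Set where
    constructor ⟪_⟫
    field get : x ≤ y

  record _≺_ (x y : ℝ) : Set where
    constructor ⟪_⟫
    field get : x < y

  open _≈_ public renaming (get to ≈⇒≃)
  open _≼_ public renaming (get to ≼⇒≤)
  open _≺_ public renaming (get to ≺⇒<)

  pointwise-≈ : ∀ {x y} → (∀ n → seq x n ≡ seq y n) → x ≈ y
  pointwise-≈ {x} {y} eq = ⟪ (λ ε 0<ε → 0 , λ n _ → subst (λ d → ℚ.∣ d ∣ ℚ.< ε)
    (trans (sym (ℚ.+-inverseʳ (seq x n))) (cong (λ q → seq x n ℚ.- q) (eq n))) 0<ε) ⟫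

  ≡⇒≈ : ∀ {x y} → x ≡ y → x ≈ y
  ≡⇒≈ refl = pointwise-≈ λ _ → refl

  ≈-sym : ∀ {x y} → x ≈ y → y ≈ x
  ≈-sym {x} {y} ⟪ p ⟫ = ⟪ (λ ε 0<ε → ev-map (λ n → subst (ℚ._< ε)
    (trans (sym (ℚ.∣-p∣≡∣p∣ (seq x n ℚ.- seq y n)))
      (cong ℚ.∣_∣ (solve 2 (λ a b → :- (a :- b) := b :- a) refl (seq x n) (seq y n)))))
    (p ε 0<ε)) ⟫

  ∣p+q∣<ε : ∀ p q r ε → p ℚ.+ q ≡ r → ℚ.∣ p ∣ ℚ.< ½ ℚ.* ε → ℚ.∣ q ∣ ℚ.< ½ ℚ.* ε → ℚ.∣ r ∣ ℚ.< ε
  ∣p+q∣<ε p q r ε refl p<½ε q<½ε = ℚ.≤-<-trans (ℚ.∣p+q∣≤∣p∣+∣q∣ p q)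
    (subst (ℚ.∣ p ∣ ℚ.+ ℚ.∣ q ∣ ℚ.<_) (½+½ ε) (ℚ.+-mono-< p<½ε q<½ε))

  ≈-trans : ∀ {x y z} → x ≈ y → y ≈ z → x ≈ z
  ≈-trans {x} {y} {z} ⟪ p ⟫ ⟪ q ⟫ = ⟪ (λ ε 0<ε → ev-map
    (λ n (f , g) → ∣p+q∣<ε (seq x n ℚ.- seq y n) (seq y n ℚ.- seq z n) (seq x n ℚ.- seq z n) ε
      (solve 3 (λ a b c → (a :- b) :+ (b :- c) := a :- c) refl (seq x n) (seq y n) (seq z n)) f g)
    (ev-zip (p _ (0<½ε 0<ε)) (q _ (0<½ε 0<ε)))) ⟫

  infixl 6 _+_ _-_
  infixl 7 _*_
  infix  8 -_

  -- Opaque copies of the ring operations: comparing two reals built from the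
  -- operations of Defs makes Agda compare their convergence proofs.
  abstract
    _+_ _*_ : ℝ → ℝ → ℝ
    _+_ = D._+_
    _*_ = D._*_

    -_ : ℝ → ℝ
    -_ = D.-_

    +-cong : ∀ {x y u v} → x ≈ y → u ≈ v → x + u ≈ y + v
    +-cong {x} {y} {u} {v} ⟪ p ⟫ ⟪ q ⟫ = ⟪ (λ ε 0<ε → ev-map
      (λ n (f , g) → ∣p+q∣<ε (seq x n ℚ.- seq y n) (seq u n ℚ.- seq v n) (seq x n ℚ.+ seq u n ℚ.- (seq y n ℚ.+ seq v n)) ε
        (solve 4 (λ a b c d → (a :- b) :+ (c :- d) := (a :+ c) :- (b :+ d)) refl
          (seq x n) (seq y n) (seq u n) (seq v n)) f g)
      (ev-zip (p _ (0<½ε 0<ε)) (q _ (0<½ε 0<ε)))) ⟫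

    -‿cong : ∀ {x y} → x ≈ y → - x ≈ - y
    -‿cong {x} {y} ⟪ p ⟫ = ⟪ (λ ε 0<ε → ev-map (λ n → subst (ℚ._< ε)
      (trans (sym (ℚ.∣-p∣≡∣p∣ (seq x n ℚ.- seq y n)))
        (cong ℚ.∣_∣ (solve 2 (λ a b → :- (a :- b) := :- a :- :- b) refl (seq x n) (seq y n)))))
      (p ε 0<ε)) ⟫

    -- By ac - bd = a(c - d) + d(a - b), only `x` and `v` need eventual bounds.
    *-cong : ∀ {x y u v} → x ≈ y → u ≈ v → x * u ≈ y * v
    *-cong {x} {y} {u} {v} ⟪ p ⟫ ⟪ q ⟫ = ⟪ lemma ⟫
      where
      diff : ∀ a b c d → a ℚ.* (c ℚ.- d) ℚ.+ d ℚ.* (a ℚ.- b) ≡ a ℚ.* c ℚ.- b ℚ.* d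
      diff = solve 4 (λ a b c d → a :* (c :- d) :+ d :* (a :- b) := a :* c :- b :* d) refl

      step : ∀ {B C δ η} ε a b c d → B ℚ.* δ ≡ ½ ℚ.* ε → C ℚ.* η ≡ ½ ℚ.* ε →
        (ℚ.∣ a ∣ ℚ.< B × ℚ.∣ c ℚ.- d ∣ ℚ.< δ) × (ℚ.∣ d ∣ ℚ.< C × ℚ.∣ a ℚ.- b ∣ ℚ.< η) →
        ℚ.∣ a ℚ.* c ℚ.- b ℚ.* d ∣ ℚ.< ε
      step {B} {C} {δ} {η} ε a b c d Bδ Cη ((a<B , cd<δ) , (d<C , ab<η)) =
        ∣p+q∣<ε (a ℚ.* (c ℚ.- d)) (d ℚ.* (a ℚ.- b)) (a ℚ.* c ℚ.- b ℚ.* d) ε (diff a b c d)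
          (subst (ℚ.∣ a ℚ.* (c ℚ.- d) ∣ ℚ.<_) Bδ (∣p*q∣<B*C a (c ℚ.- d) B δ a<B cd<δ))
          (subst (ℚ.∣ d ℚ.* (a ℚ.- b) ∣ ℚ.<_) Cη (∣p*q∣<B*C d (a ℚ.- b) C η d<C ab<η))

      lemma : x * u ≃ y * v
      lemma ε 0<ε =
        let B , 0<B , x<B = bounded x
            C , 0<C , v<C = bounded v
            δ , 0<δ , Bδ  = quotient 0<B (0<½ε 0<ε)
            η , 0<η , Cη  = quotient 0<C (0<½ε 0<ε)
        in ev-map
          (λ n → step {B} {C} {δ} {η} ε (seq x n) (seq y n) (seq u n) (seq v n) Bδ Cη)
          (ev-zip (ev-zip x<B (q δ 0<δ)) (ev-zip v<C (p η 0<η)))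

    +-assoc : ∀ x y z → (x + y) + z ≈ x + (y + z)
    +-assoc x y z = pointwise-≈ λ n → ℚ.+-assoc (seq x n) (seq y n) (seq z n)

    +-identityˡ : ∀ x → 0ℝ + x ≈ x
    +-identityˡ x = pointwise-≈ λ n → ℚ.+-identityˡ (seq x n)

    +-identityʳ : ∀ x → x + 0ℝ ≈ x
    +-identityʳ x = pointwise-≈ λ n → ℚ.+-identityʳ (seq x n)

    +-inverseˡ : ∀ x → - x + x ≈ 0ℝ
    +-inverseˡ x = pointwise-≈ λ n → ℚ.+-inverseˡ (seq x n)

    +-inverseʳ : ∀ x → x + - x ≈ 0ℝ
    +-inverseʳ x = pointwise-≈ λ n → ℚ.+-inverseʳ (seq x n)

    +-comm : ∀ x y → x + y ≈ y + x
    +-comm x y = pointwise-≈ λ n → ℚ.+-comm (seq x n) (seq y n)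

    *-assoc : ∀ x y z → (x * y) * z ≈ x * (y * z)
    *-assoc x y z = pointwise-≈ λ n → ℚ.*-assoc (seq x n) (seq y n) (seq z n)

    *-identityˡ : ∀ x → 1ℝ * x ≈ x
    *-identityˡ x = pointwise-≈ λ n → ℚ.*-identityˡ (seq x n)

    *-identityʳ : ∀ x → x * 1ℝ ≈ x
    *-identityʳ x = pointwise-≈ λ n → ℚ.*-identityʳ (seq x n)

    *-distribˡ-+ : ∀ x y z → x * (y + z) ≈ x * y + x * z
    *-distribˡ-+ x y z = pointwise-≈ λ n → ℚ.*-distribˡ-+ (seq x n) (seq y n) (seq z n)

    *-distribʳ-+ : ∀ x y z → (y + z) * x ≈ y * x + z * x
    *-distribʳ-+ x y z = pointwise-≈ λ n → ℚ.*-distribʳ-+ (seq x n) (seq y n) (seq z n)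

    *-comm : ∀ x y → x * y ≈ y * x
    *-comm x y = pointwise-≈ λ n → ℚ.*-comm (seq x n) (seq y n)

    fromℚ-+ : ∀ p q → fromℚ (p ℚ.+ q) ≈ fromℚ p + fromℚ q
    fromℚ-+ p q = pointwise-≈ λ _ → refl

    fromℚ-* : ∀ p q → fromℚ (p ℚ.* q) ≈ fromℚ p * fromℚ q
    fromℚ-* p q = pointwise-≈ λ _ → refl

    fromℚ-neg : ∀ p → fromℚ (ℚ.- p) ≈ - fromℚ p
    fromℚ-neg p = pointwise-≈ λ _ → refl

    D+≈+ : ∀ x y → x D.+ y ≈ x + y
    D+≈+ x y = pointwise-≈ λ _ → refl

    D-≈- : ∀ x y → x D.- y ≈ x + - y
    D-≈- x y = pointwise-≈ λ _ → refl

    D*≈* : ∀ x y → x D.* y ≈ x * y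
    D*≈* x y = pointwise-≈ λ _ → refl

  _-_ : ℝ → ℝ → ℝ
  x - y = x + - y

  ℝ-commutativeRing : CommutativeRing 0ℓ 0ℓ
  ℝ-commutativeRing = record
    { Carrier = ℝ ; _≈_ = _≈_ ; _+_ = _+_ ; _*_ = _*_ ; -_ = -_ ; 0# = 0ℝ ; 1# = 1ℝ
    ; isCommutativeRing = record
      { isRing = record
        { +-isAbelianGroup = record
          { isGroup = record
            { isMonoid = record
              { isSemigroup = record
                { isMagma = record
                  { isEquivalence = record
                    { refl  = pointwise-≈ λ _ → refl
                    ; sym   = ≈-sym
                    ; trans = ≈-trans }
                  ; ∙-cong = +-cong }
                ; assoc = +-assoc }
              ; identity = +-identityˡ , +-identityʳ }
            ; inverse = +-inverseˡ , +-inverseʳ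
            ; ⁻¹-cong = -‿cong }
          ; comm = +-comm }
        ; *-cong = *-cong
        ; *-assoc = *-assoc
        ; *-identity = *-identityˡ , *-identityʳ
        ; distrib = *-distribˡ-+ , *-distribʳ-+ }
      ; *-comm = *-comm } }

  open CommutativeRing ℝ-commutativeRing public
    using (setoid; +-congˡ; +-congʳ; *-congˡ; *-congʳ; zeroˡ; zeroʳ) renaming (refl to ≈-refl)
  open SemiringSum (CommutativeRing.semiring ℝ-commutativeRing) public
    using (sum; ∑-comm; *-distribˡ-sum; *-distribʳ-sum)

  -- Rational coefficients let the ring solver compute with numerals such as ½ inside identities
  -- between reals.
  fromℚ-morphism : CommutativeRing.rawRing ℚ.+-*-commutativeRing -Raw-AlmostCommutative⟶ fromCommutativeRing ℝ-commutativeRing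
  fromℚ-morphism = record
    { ⟦_⟧    = fromℚ
    ; +-homo = fromℚ-+
    ; *-homo = fromℚ-*
    ; -‿homo = fromℚ-neg
    ; 0-homo = ≈-refl
    ; 1-homo = ≈-refl
    }

  fromℚ-≟ : ∀ p q → Maybe (fromℚ p ≈ fromℚ q)
  fromℚ-≟ p q = map (λ p≡q → ≡⇒≈ (cong fromℚ p≡q)) (dec⇒maybe (p ℚ.≟ q))

  module ℝS = RingSolver (CommutativeRing.rawRing ℚ.+-*-commutativeRing) (fromCommutativeRing ℝ-commutativeRing)
    fromℚ-morphism fromℚ-≟

  sum-cong : ∀ {n} {f g : Fin n → ℝ} → (∀ i → f i ≈ g i) → sum f ≈ sum g
  sum-cong {zero}  f≈g = ≈-refl
  sum-cong {suc n} f≈g = +-cong (f≈g zero) (sum-cong λ i → f≈g (suc i))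

  ∑≈sum : ∀ {n} {f g : Fin n → ℝ} → (∀ i → f i ≈ g i) → ∑ f ≈ sum g
  ∑≈sum {zero}          f≈g = ≈-refl
  ∑≈sum {suc n} {f} {g} f≈g = ≈-trans (pointwise-≈ {y = f zero D.+ ∑ λ i → f (suc i)} λ _ → refl)
    (≈-trans (D+≈+ (f zero) (∑ λ i → f (suc i))) (+-cong (f≈g zero) (∑≈sum λ i → f≈g (suc i))))

  -- Order of the reals

  pointwise-≼ : ∀ {x y} → (∀ n → seq x n ℚ.≤ seq y n) → x ≼ y
  pointwise-≼ {x} {y} x≤y = ⟪ (λ ε 0<ε → 0 , λ n _ → ℚ.≤-<-trans (x≤y n)
    (subst (ℚ._< seq y n ℚ.+ ε) (ℚ.+-identityʳ (seq y n)) (ℚ.+-monoʳ-< (seq y n) 0<ε))) ⟫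

  <-shift-ε : ∀ a b ε → a ℚ.- b ℚ.< ε → a ℚ.< b ℚ.+ ε
  <-shift-ε a b ε h = <-shift {a ℚ.- b} {ε} h (solve 3 (λ a b e → e :- (a :- b) := (b :+ e) :- a) refl a b ε)

  <-+-mono : ∀ a b c d ε → a ℚ.< b ℚ.+ ½ ℚ.* ε → c ℚ.< d ℚ.+ ½ ℚ.* ε → a ℚ.+ c ℚ.< (b ℚ.+ d) ℚ.+ ε
  <-+-mono a b c d ε p q = subst (a ℚ.+ c ℚ.<_)
    (solve 3 (λ b d e → (b :+ con ½ :* e) :+ (d :+ con ½ :* e) := (b :+ d) :+ e) refl b d ε)
    (ℚ.+-mono-< {a} {b ℚ.+ ½ ℚ.* ε} {c} {d ℚ.+ ½ ℚ.* ε} p q)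

  <-trans-½ : ∀ a b c ε → a ℚ.< b ℚ.+ ½ ℚ.* ε → b ℚ.< c ℚ.+ ½ ℚ.* ε → a ℚ.< c ℚ.+ ε
  <-trans-½ a b c ε p q = <-shift (<-+-mono a b b c ε p q)
    (solve 4 (λ a b c e → (b :+ c) :+ e :- (a :+ b) := c :+ e :- a) refl a b c ε)

  ≈⇒≼ : ∀ {x y} → x ≈ y → x ≼ y
  ≈⇒≼ {x} {y} ⟪ p ⟫ = ⟪ (λ ε 0<ε → ev-map
    (λ n h → <-shift-ε (seq x n) (seq y n) ε (ℚ.≤-<-trans (p≤∣p∣ (seq x n ℚ.- seq y n)) h)) (p ε 0<ε)) ⟫

  ≼-trans : ∀ {x y z} → x ≼ y → y ≼ z → x ≼ z
  ≼-trans {x} {y} {z} ⟪ p ⟫ ⟪ q ⟫ = ⟪ (λ ε 0<ε → ev-map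
    (λ n (f , g) → <-trans-½ (seq x n) (seq y n) (seq z n) ε f g)
    (ev-zip (p _ (0<½ε 0<ε)) (q _ (0<½ε 0<ε)))) ⟫

  ≼-antisym : ∀ {x y} → x ≼ y → y ≼ x → x ≈ y
  ≼-antisym {x} {y} ⟪ p ⟫ ⟪ q ⟫ = ⟪ (λ ε 0<ε → ev-map
    (λ n (f , g) → ∣p∣<q {seq x n ℚ.- seq y n}
      (<-shift f (solve 3 (λ a b e → b :+ e :- a := e :- (a :- b)) refl (seq x n) (seq y n) ε))
      (<-shift g (solve 3 (λ a b e → a :+ e :- b := e :- (:- (a :- b))) refl (seq x n) (seq y n) ε)))
    (ev-zip (p ε 0<ε) (q ε 0<ε))) ⟫

  ≺-≼-trans : ∀ {x y z} → x ≺ y → y ≼ z → x ≺ z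
  ≺-≼-trans {x} {y} {z} ⟪ ε , 0<ε , x<y ⟫ ⟪ y≤z ⟫ = ⟪ ½ ℚ.* ε , 0<½ε 0<ε , ev-map
    (λ n (f , g) → step (seq x n) (seq y n) (seq z n) f g) (ev-zip x<y (y≤z _ (0<½ε 0<ε))) ⟫
    where
    step : ∀ a b c → a ℚ.+ ε ℚ.< b → b ℚ.< c ℚ.+ ½ ℚ.* ε → a ℚ.+ ½ ℚ.* ε ℚ.< c
    step a b c f g = <-shift (ℚ.<-trans f g)
      (solve 3 (λ a c e → c :+ con ½ :* e :- (a :+ e) := c :- (a :+ con ½ :* e)) refl a c ε)

  ≺⇒≼ : ∀ {x y} → x ≺ y → x ≼ y
  ≺⇒≼ {x} {y} ⟪ δ , 0<δ , x<y ⟫ = ⟪ (λ ε 0<ε → ev-map (λ n → step ε (seq x n) (seq y n) 0<ε) x<y) ⟫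
    where
    step : ∀ ε a b → 0ℚ ℚ.< ε → a ℚ.+ δ ℚ.< b → a ℚ.< b ℚ.+ ε
    step ε a b 0<ε h = <-shift (ℚ.+-mono-< {a ℚ.+ δ} {b} {0ℚ ℚ.+ 0ℚ} {δ ℚ.+ ε} h (ℚ.+-mono-< 0<δ 0<ε))
      (solve 4 (λ a b d e → b :+ (d :+ e) :- (a :+ d :+ (con 0ℚ :+ con 0ℚ)) := b :+ e :- a) refl a b δ ε)

  -- At a fixed accuracy the approximations decide x ≤ y up to ε, and they refute it only when y < x.
  ≮⇒≼ : ∀ {x y} → ¬ (y ≺ x) → x ≼ y
  ≮⇒≼ {x} {y} y≮x = ⟪ lemma ⟫
    where
    x-close : ∀ {ε a b c d} → ℚ.∣ a ℚ.- c ∣ ℚ.< ½ ℚ.* (½ ℚ.* ε) → ℚ.∣ b ℚ.- d ∣ ℚ.< ½ ℚ.* (½ ℚ.* ε) → a ℚ.- b ℚ.< c ℚ.- d ℚ.+ ½ ℚ.* ε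
    x-close {ε} {a} {b} {c} {d} p q = <-shift
      (ℚ.+-mono-< {a ℚ.- c} {½ ℚ.* (½ ℚ.* ε)} {ℚ.- (b ℚ.- d)} {½ ℚ.* (½ ℚ.* ε)}
        (ℚ.≤-<-trans (p≤∣p∣ (a ℚ.- c)) p) (ℚ.≤-<-trans (-p≤∣p∣ (b ℚ.- d)) q))
      (solve 5 (λ a b c d e → con ½ :* (con ½ :* e) :+ con ½ :* (con ½ :* e) :- ((a :- c) :+ :- (b :- d)) := c :- d :+ con ½ :* e :- (a :- b)) refl a b c d ε)

    above : ∀ {ε a b c d} → a ℚ.- b ℚ.≤ ½ ℚ.* ε → c ℚ.- d ℚ.< a ℚ.- b ℚ.+ ½ ℚ.* ε → c ℚ.< d ℚ.+ ε
    above {ε} {a} {b} {c} {d} p q = <-shift (ℚ.+-mono-≤-< {a ℚ.- b} {½ ℚ.* ε} {c ℚ.- d} {a ℚ.- b ℚ.+ ½ ℚ.* ε} p q)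
      (solve 5 (λ a b c d e → con ½ :* e :+ (a :- b :+ con ½ :* e) :- ((a :- b) :+ (c :- d)) := d :+ e :- c) refl a b c d ε)

    below : ∀ {ε a b c d} δ → δ ℚ.< (a ℚ.- b) ℚ.- ½ ℚ.* ε → a ℚ.- b ℚ.< c ℚ.- d ℚ.+ ½ ℚ.* ε → d ℚ.+ δ ℚ.< c
    below {ε} {a} {b} {c} {d} δ p q = <-shift (ℚ.+-mono-< {δ} {(a ℚ.- b) ℚ.- ½ ℚ.* ε} {a ℚ.- b} {c ℚ.- d ℚ.+ ½ ℚ.* ε} p q)
      (solve 6 (λ a b c d e δ → (a :- b :- con ½ :* e) :+ (c :- d :+ con ½ :* e) :- (δ :+ (a :- b)) := c :- (d :+ δ)) refl a b c d ε δ)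

    0<diff : ∀ {p q} → p ℚ.< q → 0ℚ ℚ.< q ℚ.- p
    0<diff {p} {q} h = <-shift h (solve 2 (λ p q → q :- p := q :- p :- con 0ℚ) refl p q)

    decide : ∀ ε → 0ℚ ℚ.< ε → ∀ N →
      (∀ n → N ℕ.≤ n → seq x n ℚ.- seq y n ℚ.< seq x N ℚ.- seq y N ℚ.+ ½ ℚ.* ε) →
      (∀ n → N ℕ.≤ n → seq x N ℚ.- seq y N ℚ.< seq x n ℚ.- seq y n ℚ.+ ½ ℚ.* ε) →
      Dec (seq x N ℚ.- seq y N ℚ.≤ ½ ℚ.* ε) → Eventually (λ n → seq x n ℚ.< seq y n ℚ.+ ε)
    decide ε 0<ε N f g (yes p) = N , λ n N≤n → above {ε} {seq x N} {seq y N} p (f n N≤n)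
    decide ε 0<ε N f g (no ¬p) = contradiction
      (⟪ ½ ℚ.* (seq x N ℚ.- seq y N ℚ.- ½ ℚ.* ε) , 0<½ε 0<d , N ,
        (λ n N≤n → below {ε} {seq x N} {seq y N} _ (½d<d 0<d) (g n N≤n)) ⟫) y≮x
      where
      0<d : 0ℚ ℚ.< seq x N ℚ.- seq y N ℚ.- ½ ℚ.* ε
      0<d = 0<diff (ℚ.≰⇒> ¬p)
      ½d<d : ∀ {d} → 0ℚ ℚ.< d → ½ ℚ.* d ℚ.< d
      ½d<d {d} 0<d = <-shift (0<½ε 0<d) (solve 1 (λ d → con ½ :* d :- con 0ℚ := d :- con ½ :* d) refl d)

    lemma : x ≤ y
    lemma ε 0<ε =
      let M , f = cauchy x _ (0<½ε (0<½ε 0<ε))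
          N , g = cauchy y _ (0<½ε (0<½ε 0<ε))
          M≤ = ℕ.m≤m⊔n M N
          N≤ = ℕ.m≤n⊔m M N
      in decide ε 0<ε (M ℕ.⊔ N)
        (λ n p → x-close {ε} {seq x n} {seq y n} {seq x (M ℕ.⊔ N)} {seq y (M ℕ.⊔ N)} (f n (M ℕ.⊔ N) (ℕ.≤-trans M≤ p) M≤) (g n (M ℕ.⊔ N) (ℕ.≤-trans N≤ p) N≤))
        (λ n p → x-close {ε} {seq x (M ℕ.⊔ N)} {seq y (M ℕ.⊔ N)} {seq x n} {seq y n} (f (M ℕ.⊔ N) n M≤ (ℕ.≤-trans M≤ p)) (g (M ℕ.⊔ N) n N≤ (ℕ.≤-trans N≤ p)))
        (seq x (M ℕ.⊔ N) ℚ.- seq y (M ℕ.⊔ N) ℚ.≤? ½ ℚ.* ε)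

  ≼-refl : ∀ {x} → x ≼ x
  ≼-refl = ≈⇒≼ ≈-refl

  abstract
    +-mono-≼ : ∀ {x y u v} → x ≼ y → u ≼ v → x + u ≼ y + v
    +-mono-≼ {x} {y} {u} {v} ⟪ p ⟫ ⟪ q ⟫ = ⟪ (λ ε 0<ε → ev-map
      (λ n (f , g) → <-+-mono (seq x n) (seq y n) (seq u n) (seq v n) ε f g)
      (ev-zip (p _ (0<½ε 0<ε)) (q _ (0<½ε 0<ε)))) ⟫

    *-monoˡ-≼ : ∀ {x y z} → 0ℝ ≺ z → x ≼ y → z * x ≼ z * y
    *-monoˡ-≼ {x} {y} {z} ⟪ γ , 0<γ , 0<z ⟫ ⟪ x≤y ⟫ = ⟪ lemma ⟫
      where
      step : ∀ {B δ ε} → 0ℚ ℚ.< δ → B ℚ.* δ ≡ ε → ∀ a b c → 0ℚ ℚ.+ γ ℚ.< c → ℚ.∣ c ∣ ℚ.< B → a ℚ.< b ℚ.+ δ →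
        c ℚ.* a ℚ.< c ℚ.* b ℚ.+ ε
      step {B} {δ} {ε} 0<δ Bδ a b c γ<c c<B a<b = ℚ.<-trans
        (subst (c ℚ.* a ℚ.<_) (ℚ.*-distribˡ-+ c b δ) (ℚ.*-monoʳ-<-pos c {{ℚ.positive 0<c}} a<b))
        (subst (λ e → c ℚ.* b ℚ.+ c ℚ.* δ ℚ.< c ℚ.* b ℚ.+ e) Bδ
          (ℚ.+-monoʳ-< (c ℚ.* b) (ℚ.*-monoˡ-<-pos δ {{ℚ.positive 0<δ}} (ℚ.≤-<-trans (p≤∣p∣ c) c<B))))
        where
        0<c : 0ℚ ℚ.< c
        0<c = ℚ.<-trans 0<γ (subst (ℚ._< c) (ℚ.+-identityˡ γ) γ<c)

      lemma : z * x ≤ z * y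
      lemma ε 0<ε =
        let B , 0<B , z<B = bounded z
            δ , 0<δ , Bδ  = quotient 0<B 0<ε
        in ev-map (λ n ((f , g) , h) → step 0<δ Bδ (seq x n) (seq y n) (seq z n) f g h)
          (ev-zip (ev-zip 0<z z<B) (x≤y δ 0<δ))

    -- The witness γ of 0 < z is an eventual lower bound for `z`, so an error γε in the products
    -- leaves an error of at most ε after cancelling.
    *-cancelʳ-≼ : ∀ {x y z} → 0ℝ ≺ z → x * z ≼ y * z → x ≼ y
    *-cancelʳ-≼ {x} {y} {z} ⟪ γ , 0<γ , 0<z ⟫ ⟪ xz≤yz ⟫ = ⟪ (λ ε 0<ε → ev-map
      (λ n (f , g) → step 0<ε (seq x n) (seq y n) (seq z n) f g)
      (ev-zip 0<z (xz≤yz (γ ℚ.* ε) (*-pos 0<γ 0<ε)))) ⟫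
      where
      step : ∀ {ε} → 0ℚ ℚ.< ε → ∀ a b c → 0ℚ ℚ.+ γ ℚ.< c → a ℚ.* c ℚ.< b ℚ.* c ℚ.+ γ ℚ.* ε → a ℚ.< b ℚ.+ ε
      step {ε} 0<ε a b c f ac<bc = ℚ.*-cancelʳ-<-nonNeg c {{ℚ.nonNegative (ℚ.<⇒≤ (ℚ.<-trans 0<γ γ<c))}}
        (ℚ.<-trans ac<bc
          (subst (b ℚ.* c ℚ.+ γ ℚ.* ε ℚ.<_)
            (solve 3 (λ b c e → b :* c :+ c :* e := (b :+ e) :* c) refl b c ε)
            (ℚ.+-monoʳ-< (b ℚ.* c) (ℚ.*-monoˡ-<-pos ε {{ℚ.positive 0<ε}} γ<c))))
        where
        γ<c : γ ℚ.< c
        γ<c = subst (ℚ._< c) (ℚ.+-identityˡ γ) f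

    0≺* : ∀ {x y} → 0ℝ ≺ x → 0ℝ ≺ y → 0ℝ ≺ x * y
    0≺* {x} {y} ⟪ γ , 0<γ , 0<x ⟫ ⟪ δ , 0<δ , 0<y ⟫ = ⟪ γ ℚ.* δ , *-pos 0<γ 0<δ ,
      ev-map (λ n (f , g) → step (seq x n) (seq y n) f g) (ev-zip 0<x 0<y) ⟫
      where
      step : ∀ a b → 0ℚ ℚ.+ γ ℚ.< a → 0ℚ ℚ.+ δ ℚ.< b → 0ℚ ℚ.+ γ ℚ.* δ ℚ.< a ℚ.* b
      step a b γ<a δ<b = subst (ℚ._< a ℚ.* b) (sym (ℚ.+-identityˡ (γ ℚ.* δ)))
        (ℚ.<-trans
          (ℚ.*-monoʳ-<-pos γ {{ℚ.positive 0<γ}} (subst (ℚ._< b) (ℚ.+-identityˡ δ) δ<b))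
          (ℚ.*-monoˡ-<-pos b {{ℚ.positive (ℚ.<-trans 0<δ (subst (ℚ._< b) (ℚ.+-identityˡ δ) δ<b))}}
            (subst (ℚ._< a) (ℚ.+-identityˡ γ) γ<a)))

  -- Absolute values and finite sums

  abstract
    ∣_∣ : ℝ → ℝ
    ∣ x ∣ = mkℝ (λ n → ℚ.∣ seq x n ∣) λ ε 0<ε → let N , h = cauchy x ε 0<ε in N , λ m n p q →
      ℚ.≤-<-trans (∣∣p∣-∣q∣∣≤∣p-q∣ (seq x m) (seq x n)) (h m n p q)

    ∣-∣-cong : ∀ {x y} → x ≈ y → ∣ x ∣ ≈ ∣ y ∣
    ∣-∣-cong {x} {y} ⟪ p ⟫ = ⟪ (λ ε 0<ε → ev-map
      (λ n → ℚ.≤-<-trans (∣∣p∣-∣q∣∣≤∣p-q∣ (seq x n) (seq y n))) (p ε 0<ε)) ⟫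

    0≼∣_∣ : ∀ x → 0ℝ ≼ ∣ x ∣
    0≼∣ x ∣ = pointwise-≼ λ n → ℚ.0≤∣p∣ (seq x n)

    x≼∣x∣ : ∀ x → x ≼ ∣ x ∣
    x≼∣x∣ x = pointwise-≼ λ n → p≤∣p∣ (seq x n)

    ∣0∣ : ∣ 0ℝ ∣ ≈ 0ℝ
    ∣0∣ = pointwise-≈ λ _ → refl

    ∣1∣ : ∣ 1ℝ ∣ ≈ 1ℝ
    ∣1∣ = pointwise-≈ λ _ → refl

    ∣x+y∣≼∣x∣+∣y∣ : ∀ x y → ∣ x + y ∣ ≼ ∣ x ∣ + ∣ y ∣
    ∣x+y∣≼∣x∣+∣y∣ x y = pointwise-≼ λ n → ℚ.∣p+q∣≤∣p∣+∣q∣ (seq x n) (seq y n)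

    ∣x*y∣≈∣x∣*∣y∣ : ∀ x y → ∣ x * y ∣ ≈ ∣ x ∣ * ∣ y ∣
    ∣x*y∣≈∣x∣*∣y∣ x y = pointwise-≈ λ n → ℚ.∣p*q∣≡∣p∣*∣q∣ (seq x n) (seq y n)

    -- Holds without knowing the sign of `x`, so it applies to an arbitrary eigenvalue.
    x*∣y∣≼∣x*y∣ : ∀ x y → x * ∣ y ∣ ≼ ∣ x * y ∣
    x*∣y∣≼∣x*y∣ x y = pointwise-≼ λ n → subst (seq x n ℚ.* ℚ.∣ seq y n ∣ ℚ.≤_) (sym (ℚ.∣p*q∣≡∣p∣*∣q∣ (seq x n) (seq y n)))
      (ℚ.*-monoʳ-≤-nonNeg ℚ.∣ seq y n ∣ {{ℚ.∣-∣-nonNeg (seq y n)}} (p≤∣p∣ (seq x n)))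

    -- Turns the apartness in the definition of an eigenvector into a strictly positive summand of
    -- the pairing with a positive vector.
    #0⇒0≺∣_∣ : ∀ x → x # 0ℝ → 0ℝ ≺ ∣ x ∣
    #0⇒0≺∣ x ∣ (inj₂ 0<x) = ≺-≼-trans ⟪ 0<x ⟫ (x≼∣x∣ x)
    #0⇒0≺∣ x ∣ (inj₁ (ε , 0<ε , x<0)) = ⟪ ε , 0<ε , ev-map
      (λ n h → ℚ.<-≤-trans
        (<-shift h (solve 2 (λ a e → con 0ℚ :- (a :+ e) := :- a :- (con 0ℚ :+ e)) refl (seq x n) ε))
        (-p≤∣p∣ (seq x n))) x<0 ⟫

  0≼+ : ∀ {x y} → 0ℝ ≼ x → 0ℝ ≼ y → 0ℝ ≼ x + y
  0≼+ 0≼x 0≼y = ≼-trans (≈⇒≼ (≈-sym (+-identityˡ 0ℝ))) (+-mono-≼ 0≼x 0≼y)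

  0≼* : ∀ {x y} → 0ℝ ≺ x → 0ℝ ≼ y → 0ℝ ≼ x * y
  0≼* {x} 0≺x 0≼y = ≼-trans (≈⇒≼ (≈-sym (zeroʳ x))) (*-monoˡ-≼ 0≺x 0≼y)

  0≺+ : ∀ {x y} → 0ℝ ≺ x → 0ℝ ≼ y → 0ℝ ≺ x + y
  0≺+ {x} 0≺x 0≼y = ≺-≼-trans 0≺x (≼-trans (≈⇒≼ (≈-sym (+-identityʳ x))) (+-mono-≼ ≼-refl 0≼y))

  sum-mono-≼ : ∀ {n} {f g : Fin n → ℝ} → (∀ i → f i ≼ g i) → sum f ≼ sum g
  sum-mono-≼ {zero}  f≼g = ≼-refl
  sum-mono-≼ {suc n} f≼g = +-mono-≼ (f≼g zero) (sum-mono-≼ λ i → f≼g (suc i))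

  0≼sum : ∀ {n} {f : Fin n → ℝ} → (∀ i → 0ℝ ≼ f i) → 0ℝ ≼ sum f
  0≼sum {zero}  0≼f = ≼-refl
  0≼sum {suc n} 0≼f = 0≼+ (0≼f zero) (0≼sum λ i → 0≼f (suc i))

  0≺sum : ∀ {n} {f : Fin n → ℝ} → (∀ i → 0ℝ ≼ f i) → ∀ i → 0ℝ ≺ f i → 0ℝ ≺ sum f
  0≺sum         0≼f zero    0≺fᵢ = 0≺+ 0≺fᵢ (0≼sum λ i → 0≼f (suc i))
  0≺sum {f = f} 0≼f (suc i) 0≺fᵢ = ≺-≼-trans (0≺+ (0≺sum (λ j → 0≼f (suc j)) i 0≺fᵢ) (0≼f zero))
    (≈⇒≼ (+-comm _ (f zero)))

  ∣sum∣≼sum∣∣ : ∀ {n} (f : Fin n → ℝ) → ∣ sum f ∣ ≼ sum (λ i → ∣ f i ∣)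
  ∣sum∣≼sum∣∣ {zero}  f = ≈⇒≼ ∣0∣
  ∣sum∣≼sum∣∣ {suc n} f = ≼-trans (∣x+y∣≼∣x∣+∣y∣ (f zero) _) (+-mono-≼ ≼-refl (∣sum∣≼sum∣∣ λ i → f (suc i)))

  ≺-irrefl : ∀ {x} → ¬ (x ≺ x)
  ≺-irrefl {x} ⟪ ε , 0<ε , N , h ⟫ = ℚ.<-asym (h N ℕ.≤-refl)
    (subst (ℚ._< seq x N ℚ.+ ε) (ℚ.+-identityʳ (seq x N)) (ℚ.+-monoʳ-< (seq x N) 0<ε))

  ≼-preorder : Preorder 0ℓ 0ℓ 0ℓ
  ≼-preorder = record
    { Carrier = ℝ ; _≈_ = _≈_ ; _≲_ = _≼_
    ; isPreorder = record
      { isEquivalence = CommutativeRing.isEquivalence ℝ-commutativeRing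
      ; reflexive     = ≈⇒≼
      ; trans         = ≼-trans } }

  toℚᵘ-/1 : ∀ z → ℚ.toℚᵘ (z ℚ./ 1) ℚᵘ.≃ ℚᵘ.mkℚᵘ z 0
  toℚᵘ-/1 z = ℚ.toℚᵘ-fromℚᵘ (ℚᵘ.mkℚᵘ z 0)

  -- Passing to unnormalised rationals avoids reducing fractions; there the claim is an identity of
  -- integers.
  /1-homo-+ : ∀ y z → (y ℤ.+ z) ℚ./ 1 ≡ y ℚ./ 1 ℚ.+ z ℚ./ 1
  /1-homo-+ y z = ℚ.toℚᵘ-injective (begin
    ℚ.toℚᵘ ((y ℤ.+ z) ℚ./ 1)                   ≈⟨ toℚᵘ-/1 (y ℤ.+ z) ⟩
    ℚᵘ.mkℚᵘ (y ℤ.+ z) 0                        ≈⟨ ℚᵘ.*≡* (cong (ℤ._* + 1) (cong₂ ℤ._+_ (sym (ℤ.*-identityʳ y)) (sym (ℤ.*-identityʳ z)))) ⟩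
    ℚᵘ.mkℚᵘ y 0 ℚᵘ.+ ℚᵘ.mkℚᵘ z 0               ≈⟨ ℚᵘ.+-cong (toℚᵘ-/1 y) (toℚᵘ-/1 z) ⟨
    ℚ.toℚᵘ (y ℚ./ 1) ℚᵘ.+ ℚ.toℚᵘ (z ℚ./ 1)     ≈⟨ ℚ.toℚᵘ-homo-+ (y ℚ./ 1) (z ℚ./ 1) ⟨
    ℚ.toℚᵘ (y ℚ./ 1 ℚ.+ z ℚ./ 1)               ∎)
    where open ℚᵘ.≃-Reasoning

  /1-homo-* : ∀ y z → (y ℤ.* z) ℚ./ 1 ≡ (y ℚ./ 1) ℚ.* (z ℚ./ 1)
  /1-homo-* y z = ℚ.toℚᵘ-injective (begin
    ℚ.toℚᵘ ((y ℤ.* z) ℚ./ 1)                   ≈⟨ toℚᵘ-/1 (y ℤ.* z) ⟩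
    ℚᵘ.mkℚᵘ y 0 ℚᵘ.* ℚᵘ.mkℚᵘ z 0               ≈⟨ ℚᵘ.*-cong (toℚᵘ-/1 y) (toℚᵘ-/1 z) ⟨
    ℚ.toℚᵘ (y ℚ./ 1) ℚᵘ.* ℚ.toℚᵘ (z ℚ./ 1)     ≈⟨ ℚ.toℚᵘ-homo-* (y ℚ./ 1) (z ℚ./ 1) ⟨
    ℚ.toℚᵘ ((y ℚ./ 1) ℚ.* (z ℚ./ 1))               ∎)
    where open ℚᵘ.≃-Reasoning

  /1-homo-neg : ∀ z → (ℤ.- z) ℚ./ 1 ≡ ℚ.- (z ℚ./ 1)
  /1-homo-neg z = ℚ.toℚᵘ-injective (begin
    ℚ.toℚᵘ ((ℤ.- z) ℚ./ 1)     ≈⟨ toℚᵘ-/1 (ℤ.- z) ⟩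
    ℚᵘ.- ℚᵘ.mkℚᵘ z 0           ≈⟨ ℚᵘ.-‿cong (toℚᵘ-/1 z) ⟨
    ℚᵘ.- ℚ.toℚᵘ (z ℚ./ 1)      ≈⟨ ℚ.toℚᵘ-homo‿- (z ℚ./ 1) ⟨
    ℚ.toℚᵘ (ℚ.- (z ℚ./ 1))     ∎)
    where open ℚᵘ.≃-Reasoning

  -- The denominator is at least 1, so the absolute value of the numerator already bounds `q`.
  archimedean : ∀ q → q ℚ.≤ (+ ℤ.∣ ℚ.↥ q ∣) ℚ./ 1
  archimedean q@record{} = ℚ.toℚᵘ-cancel-≤ (ℚᵘ.≤-respʳ-≃ (ℚᵘ.≃-sym (toℚᵘ-/1 (+ ℤ.∣ ℚ.↥ q ∣)))
    (ℚᵘ.*≤* (ℤ.≤-trans (ℤ.≤-reflexive (ℤ.*-identityʳ (ℚ.↥ q))) (lemma (ℚ.↥ q) (ℚ.denominator-1 q)))))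
    where
    lemma : ∀ i d → i ℤ.≤ + ℤ.∣ i ∣ ℤ.* + suc d
    lemma (+ n)    d = subst (+ n ℤ.≤_) (ℤ.pos-* n (suc d)) (ℤ.+≤+ (ℕ.m≤m*n n (suc d)))
    lemma -[1+ n ] d = ℤ.-≤+

  0≤/1 : ∀ n → 0ℚ ℚ.≤ (+ n) ℚ./ 1
  0≤/1 n = ℚ.nonNegative⁻¹ _ {{ℚ.normalize-nonNeg n 1}}

  -- Repeated halving, bisection and intermediate values

  halve : ℕ → ℚ → ℚ
  halve zero    w = w
  halve (suc n) w = ½ ℚ.* halve n w

  halve-nonneg : ∀ n {w} → 0ℚ ℚ.≤ w → 0ℚ ℚ.≤ halve n w
  halve-nonneg zero    0≤w = 0≤w
  halve-nonneg (suc n) 0≤w = *-nonneg (ℚ.nonNegative⁻¹ ½) (halve-nonneg n 0≤w)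

  -- This is n ≤ 2ⁿ scaled by `w`. The induction uses (n+2)/2 ≤ n+1; the analogous step from 0 to 1
  -- would need 1/2 ≤ 0, hence the separate case 1.
  n*halve≤w : ∀ n {w} → 0ℚ ℚ.≤ w → ((+ n) ℚ./ 1) ℚ.* halve n w ℚ.≤ w
  n*halve≤w zero {w} 0≤w = subst (ℚ._≤ w) (sym (ℚ.*-zeroˡ w)) 0≤w
  n*halve≤w (suc zero) {w} 0≤w = subst (ℚ._≤ w) (sym (ℚ.*-identityˡ (½ ℚ.* w)))
    (≤-shift (*-nonneg (ℚ.nonNegative⁻¹ ½) 0≤w)
      (solve 1 (λ w → con ½ :* w :- con 0ℚ := w :- con ½ :* w) refl w))
  n*halve≤w (suc (suc n)) {w} 0≤w = ℚ.≤-trans (lemma ((+ n) ℚ./ 1) (halve (suc n) w) (0≤/1 n) (halve-nonneg (suc n) 0≤w)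
      (/1-homo-+ (+ 2) (+ n)) (/1-homo-+ (+ 1) (+ n))) (n*halve≤w (suc n) 0≤w)
    where
    lemma : ∀ n h → 0ℚ ℚ.≤ n → 0ℚ ℚ.≤ h → ∀ {n₁ n₂} → n₂ ≡ (+ 2) ℚ./ 1 ℚ.+ n → n₁ ≡ 1ℚ ℚ.+ n → n₂ ℚ.* (½ ℚ.* h) ℚ.≤ n₁ ℚ.* h
    lemma n h 0≤n 0≤h refl refl = ≤-shift (*-nonneg (ℚ.nonNegative⁻¹ ½) (*-nonneg 0≤n 0≤h))
      (solve 2 (λ n h → con ½ :* (n :* h) :- con 0ℚ := (con 1ℚ :+ n) :* h :- (con ((+ 2) ℚ./ 1) :+ n) :* (con ½ :* h)) refl n h)

  -- With N ≥ w/ε, after N+1 halvings (N+1) times the result is at most w ≤ Nε < (N+1)ε; cancel N+1.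
  halve-small : ∀ {w} → 0ℚ ℚ.≤ w → ∀ ε → 0ℚ ℚ.< ε → ∃[ N ] halve N w ℚ.< ε
  halve-small {w} 0≤w ε 0<ε = suc N , ℚ.*-cancelˡ-<-nonNeg ((+ suc N) ℚ./ 1) {{ℚ.nonNegative (0≤/1 (suc N))}}
    (ℚ.≤-<-trans (n*halve≤w (suc N) 0≤w)
      (ℚ.≤-<-trans (subst (w ℚ.≤_) (ℚ.*-comm ε ((+ N) ℚ./ 1)) w≤Nε)
        (ℚ.*-monoˡ-<-pos ε {{ℚ.positive 0<ε}} N<1+N)))
    where
    δ : ℚ
    δ = proj₁ (divide 0<ε w)
    N : ℕ
    N = ℤ.∣ ℚ.↥ δ ∣
    w≤Nε : w ℚ.≤ ε ℚ.* ((+ N) ℚ./ 1)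
    w≤Nε = subst (ℚ._≤ ε ℚ.* ((+ N) ℚ./ 1)) (proj₂ (divide 0<ε w))
      (ℚ.*-monoˡ-≤-nonNeg ε {{ℚ.nonNegative (ℚ.<⇒≤ 0<ε)}} (archimedean δ))
    N<1+N : (+ N) ℚ./ 1 ℚ.< (+ suc N) ℚ./ 1
    N<1+N = subst₂ ℚ._<_ (ℚ.+-identityˡ _) (sym (/1-homo-+ (+ 1) (+ N))) (ℚ.+-monoˡ-< ((+ N) ℚ./ 1) (ℚ.positive⁻¹ 1ℚ))

  ∣p-q∣≤width : ∀ {l h} p q → l ℚ.≤ p → p ℚ.≤ h → l ℚ.≤ q → q ℚ.≤ h → ℚ.∣ p ℚ.- q ∣ ℚ.≤ h ℚ.- l
  ∣p-q∣≤width {l} {h} p q l≤p p≤h l≤q q≤h with ℚ.∣p∣≡p∨∣p∣≡-p (p ℚ.- q)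
  ... | inj₁ eq = subst (ℚ._≤ h ℚ.- l) (sym eq) (ℚ.+-mono-≤ p≤h (ℚ.neg-antimono-≤ l≤q))
  ... | inj₂ eq = subst (ℚ._≤ h ℚ.- l)
    (trans (solve 2 (λ p q → q :- p := :- (p :- q)) refl p q) (sym eq))
    (ℚ.+-mono-≤ q≤h (ℚ.neg-antimono-≤ l≤p))

  -- All endpoints are rational, because there the sign of `f` at a midpoint is decidable.
  module Bisection (f : ℚ → ℚ) where

    record Bracket : Set where
      field
        lo hi : ℚ
        lo≤hi : lo ℚ.≤ hi
        f-lo  : f lo ℚ.≤ 0ℚ
        f-hi  : 0ℚ ℚ.≤ f hi

      width mid : ℚ
      width = hi ℚ.- lo
      mid   = ½ ℚ.* (lo ℚ.+ hi)

      lo≤mid : lo ℚ.≤ mid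
      lo≤mid = ≤-shift (ℚ.*-monoˡ-≤-nonNeg ½ lo≤hi)
        (solve 2 (λ l h → con ½ :* h :- con ½ :* l := con ½ :* (l :+ h) :- l) refl lo hi)

      mid≤hi : mid ℚ.≤ hi
      mid≤hi = ≤-shift (ℚ.*-monoˡ-≤-nonNeg ½ lo≤hi)
        (solve 2 (λ l h → con ½ :* h :- con ½ :* l := h :- con ½ :* (l :+ h)) refl lo hi)

    open Bracket

    choose : (b : Bracket) → Dec (f (mid b) ℚ.≤ 0ℚ) → Bracket
    choose b (yes p) = record { lo = mid b ; hi = hi b ; lo≤hi = mid≤hi b ; f-lo = p ; f-hi = f-hi b }
    choose b (no ¬p) = record { lo = lo b ; hi = mid b ; lo≤hi = lo≤mid b ; f-lo = f-lo b ; f-hi = ℚ.<⇒≤ (ℚ.≰⇒> ¬p) }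

    lo≤choose : ∀ b d → lo b ℚ.≤ lo (choose b d)
    lo≤choose b (yes _) = lo≤mid b
    lo≤choose b (no  _) = ℚ.≤-refl

    choose≤hi : ∀ b d → hi (choose b d) ℚ.≤ hi b
    choose≤hi b (yes _) = ℚ.≤-refl
    choose≤hi b (no  _) = mid≤hi b

    choose-width : ∀ b d → width (choose b d) ≡ ½ ℚ.* width b
    choose-width b (yes _) = solve 2 (λ l h → h :- con ½ :* (l :+ h) := con ½ :* (h :- l)) refl (lo b) (hi b)
    choose-width b (no  _) = solve 2 (λ l h → con ½ :* (l :+ h) :- l := con ½ :* (h :- l)) refl (lo b) (hi b)

    bisect : Bracket → ℕ → Bracket
    bisect b zero    = b
    bisect b (suc n) = choose (bisect b n) (f (mid (bisect b n)) ℚ.≤? 0ℚ)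

    module _ (b : Bracket) where

      bisect-width : ∀ n → width (bisect b n) ≡ halve n (width b)
      bisect-width zero    = refl
      bisect-width (suc n) = trans (choose-width (bisect b n) (f (mid (bisect b n)) ℚ.≤? 0ℚ)) (cong (½ ℚ.*_) (bisect-width n))

      lo-+ : ∀ N d → lo (bisect b N) ℚ.≤ lo (bisect b (d ℕ.+ N))
      lo-+ N zero    = ℚ.≤-refl
      lo-+ N (suc d) = ℚ.≤-trans (lo-+ N d) (lo≤choose (bisect b (d ℕ.+ N)) (f (mid (bisect b (d ℕ.+ N))) ℚ.≤? 0ℚ))

      hi-+ : ∀ N d → hi (bisect b (d ℕ.+ N)) ℚ.≤ hi (bisect b N)
      hi-+ N zero    = ℚ.≤-refl
      hi-+ N (suc d) = ℚ.≤-trans (choose≤hi (bisect b (d ℕ.+ N)) (f (mid (bisect b (d ℕ.+ N))) ℚ.≤? 0ℚ)) (hi-+ N d)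

      lo-mono : ∀ {N m} → N ℕ.≤ m → lo (bisect b N) ℚ.≤ lo (bisect b m)
      lo-mono {N} {m} N≤m = subst (λ k → lo (bisect b N) ℚ.≤ lo (bisect b k)) (ℕ.m∸n+n≡m N≤m) (lo-+ N (m ℕ.∸ N))

      hi-anti : ∀ {N m} → N ℕ.≤ m → hi (bisect b m) ℚ.≤ hi (bisect b N)
      hi-anti {N} {m} N≤m = subst (λ k → hi (bisect b k) ℚ.≤ hi (bisect b N)) (ℕ.m∸n+n≡m N≤m) (hi-+ N (m ℕ.∸ N))

      width-nonneg : 0ℚ ℚ.≤ width b
      width-nonneg = ≤-shift (lo≤hi b) (solve 2 (λ l h → h :- l := h :- l :- con 0ℚ) refl (lo b) (hi b))

      narrow : ∀ ε → 0ℚ ℚ.< ε → ∃[ N ] width (bisect b N) ℚ.< ε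
      narrow ε 0<ε = let N , h = halve-small width-nonneg ε 0<ε in
        N , subst (ℚ._< ε) (sym (bisect-width N)) h

      close : ∀ ε → 0ℚ ℚ.< ε → ∃[ N ] ∀ p q →
        lo (bisect b N) ℚ.≤ p → p ℚ.≤ hi (bisect b N) → lo (bisect b N) ℚ.≤ q → q ℚ.≤ hi (bisect b N) → ℚ.∣ p ℚ.- q ∣ ℚ.< ε
      close ε 0<ε = let N , h = narrow ε 0<ε in
        N , λ p q l≤p p≤h l≤q q≤h → ℚ.≤-<-trans (∣p-q∣≤width p q l≤p p≤h l≤q q≤h) h

      lo≤hi-at : ∀ {N m} → N ℕ.≤ m → lo (bisect b m) ℚ.≤ hi (bisect b N)
      lo≤hi-at {m = m} N≤m = ℚ.≤-trans (lo≤hi (bisect b m)) (hi-anti N≤m)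

      lo≤hi-at′ : ∀ {N m} → N ℕ.≤ m → lo (bisect b N) ℚ.≤ hi (bisect b m)
      lo≤hi-at′ {m = m} N≤m = ℚ.≤-trans (lo-mono N≤m) (lo≤hi (bisect b m))

      loℝ hiℝ : ℝ
      loℝ = mkℝ (λ n → lo (bisect b n)) λ ε 0<ε → let N , h = close ε 0<ε in
        N , λ m n p q → h (lo (bisect b m)) (lo (bisect b n)) (lo-mono p) (lo≤hi-at p) (lo-mono q) (lo≤hi-at q)
      hiℝ = mkℝ (λ n → hi (bisect b n)) λ ε 0<ε → let N , h = close ε 0<ε in
        N , λ m n p q → h (hi (bisect b m)) (hi (bisect b n)) (lo≤hi-at′ p) (hi-anti p) (lo≤hi-at′ q) (hi-anti q)

      loℝ≈hiℝ : loℝ ≈ hiℝ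
      loℝ≈hiℝ = ⟪ (λ ε 0<ε → let N , h = close ε 0<ε in
        N , λ n p → h (lo (bisect b n)) (hi (bisect b n)) (lo-mono p) (lo≤hi-at p) (lo≤hi-at′ p) (hi-anti p)) ⟫

  fromℚ-cancel-≼ : ∀ {p q} → fromℚ p ≼ fromℚ q → p ℚ.≤ q
  fromℚ-cancel-≼ {p} {q} ⟪ p≤q ⟫ = ℚ.≮⇒≥ λ q<p →
    let N , h = p≤q (p ℚ.- q) (<-shift {q} {p} {0ℚ} {p ℚ.- q} q<p (solve 2 (λ p q → p :- q := p :- q :- con 0ℚ) refl p q)) in
    ℚ.<-irrefl (solve 2 (λ p q → p := q :+ (p :- q)) refl p q) (h N ℕ.≤-refl)

  -- `F` acts on representing sequences term by term through `f`. Hence `F` of the sequence of lower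
  -- ends is termwise at most 0, and `F` of the sequence of upper ends termwise at least 0. The two
  -- sequences represent the same real, so `F-cong` takes the place of continuity.
  intermediateValue : ∀ (F : ℝ → ℝ) (f : ℚ → ℚ) → (∀ x n → seq (F x) n ≡ f (seq x n)) →
    (∀ {x y} → x ≈ y → F x ≈ F y) → ∀ {a b} → fromℚ a ≼ fromℚ b → F (fromℚ a) ≼ 0ℝ → 0ℝ ≼ F (fromℚ b) →
    ∃[ x ] (F x ≈ 0ℝ × fromℚ a ≼ x)
  intermediateValue F f F≗f F-cong {a} {b} a≤b Fa≤0 0≤Fb = loℝ ab ,
    ≼-antisym
      (pointwise-≼ λ n → subst (ℚ._≤ 0ℚ) (sym (F≗f (loℝ ab) n)) (Bracket.f-lo (bisect ab n)))
      (≼-trans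
        (pointwise-≼ {y = F (hiℝ ab)} λ n → subst (0ℚ ℚ.≤_) (sym (F≗f (hiℝ ab) n)) (Bracket.f-hi (bisect ab n)))
        (≈⇒≼ (F-cong (≈-sym (loℝ≈hiℝ ab))))) ,
    pointwise-≼ λ n → lo-mono ab {0} {n} ℕ.z≤n
    where
    open Bisection f

    F-fromℚ : ∀ q → F (fromℚ q) ≈ fromℚ (f q)
    F-fromℚ q = pointwise-≈ (F≗f (fromℚ q))

    ab : Bracket
    ab = record
      { lo    = a
      ; hi    = b
      ; lo≤hi = fromℚ-cancel-≼ a≤b
      ; f-lo  = fromℚ-cancel-≼ (≼-trans (≈⇒≼ (≈-sym (F-fromℚ a))) Fa≤0)
      ; f-hi  = fromℚ-cancel-≼ (≼-trans 0≤Fb (≈⇒≼ (F-fromℚ b)))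
      }

-- Failure of k-factor-criticality

module FactorCriticality where

  open import Data.Fin.Subset using (Subset; inside; outside; _∈_; ∁; ∣_∣)
  open import Data.Fin.Subset.Properties using (x∈∁p⇒x∉p; x∉p⇒x∈∁p; ∣⊥∣≡0)
  open import Data.Product.Properties using (Σ-≡,≡→≡)
  open import Data.Vec.Base using ([]; _∷_; replicate; _++_; lookup)
  open import Data.Vec.Properties using ([]=⇒lookup; lookup⇒[]=; lookup-++ˡ; lookup-++ʳ; lookup-replicate)
  open import Data.Vec.Properties.WithK using ([]=-irrelevant)
  open import Defs using (Graph; adj; symm; K; _K₁; ⋁; inFirst; PerfectMatching; IsFactorCritical)

  -- Deleting Q leaves the c vertices isolated i with all their neighbours among the s vertices hub j.
  record Obstruction {n} (G : Graph (Fin n)) (k s c : ℕ) : Set where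
    field
      Q         : Subset n
      ∣Q∣≡k     : ∣ Q ∣ ≡ k
      leaf      : Fin c → Fin n
      leaf-inj  : ∀ {i j} → leaf i ≡ leaf j → i ≡ j
      leaf∉Q    : ∀ i → leaf i ∈ ∁ Q
      hub       : Fin s → Fin n
      neighbour : ∀ i w → w ∈ ∁ Q → adj G (leaf i) w ≡ true → ∃[ j ] w ≡ hub j

  open Obstruction

  -- All partners of the `c` leaves lie among `s` < `c` hubs, so by the pigeonhole principle two
  -- leaves share a partner, which then has degree at least 2 in the matching.
  obstruction⇒¬factorCritical : ∀ {n k s c} {G : Graph (Fin n)} → s ℕ.< c → Obstruction G k s c → ¬ IsFactorCritical k G
  obstruction⇒¬factorCritical {G = G} s<c O critical =
    let i , j , i<j , hub≡ = Fin.pigeonhole s<c (proj₁ ∘ partner-hub) in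
    Fin.<⇒≢ i<j (leaf-inj O (cong proj₁ (vertex-unique i j
      (∁Q-≡ (trans (proj₂ (partner-hub i)) (trans (cong (hub O) hub≡) (sym (proj₂ (partner-hub j)))))))))
    where
    open PerfectMatching (critical (Q O) (∣Q∣≡k O))

    -- The pigeonhole principle equates only underlying vertices; membership proofs are unique, so
    -- the partners coincide as vertices of the deleted graph.
    ∁Q-≡ : ∀ {u v : ∃[ v ] v ∈ ∁ (Q O)} → proj₁ u ≡ proj₁ v → u ≡ v
    ∁Q-≡ u≡v = Σ-≡,≡→≡ (u≡v , []=-irrelevant _ _)

    vertex : Fin _ → ∃[ v ] v ∈ ∁ (Q O)
    vertex i = leaf O i , leaf∉Q O i

    partner : Fin _ → ∃[ v ] v ∈ ∁ (Q O)
    partner i = proj₁ (degree-1 (vertex i))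

    matched : ∀ i → adj matching (vertex i) (partner i) ≡ true
    matched i = proj₁ (proj₂ (degree-1 (vertex i)))

    partner-hub : ∀ i → ∃[ h ] proj₁ (partner i) ≡ hub O h
    partner-hub i = neighbour O i (proj₁ (partner i)) (proj₂ (partner i)) (spanning (vertex i) (partner i) (matched i))

    vertex-unique : ∀ i j → partner i ≡ partner j → vertex i ≡ vertex j
    vertex-unique i j eq = trans (sym (unique (trans (symm matching (partner i) (vertex i)) (matched i))))
      (unique (trans (symm matching (partner i) (vertex j)) (subst (λ w → adj matching (vertex j) w ≡ true) (sym eq) (matched j))))
      where
      unique : ∀ {w} → adj matching (partner i) w ≡ true → proj₁ (degree-1 (partner i)) ≡ w
      unique = proj₂ (proj₂ (degree-1 (partner i)))

  ∈∁⇒outside : ∀ {n} {p : Subset n} {x} → x ∈ ∁ p → lookup p x ≡ outside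
  ∈∁⇒outside {p = p} {x} x∈∁p with lookup p x in eq
  ... | outside = refl
  ... | inside  = contradiction (lookup⇒[]= x p eq) (x∈∁p⇒x∉p x∈∁p)

  outside⇒∈∁ : ∀ {n} (p : Subset n) x → lookup p x ≡ outside → x ∈ ∁ p
  outside⇒∈∁ p x eq = x∉p⇒x∈∁p λ x∈p → contradiction (trans (sym eq) ([]=⇒lookup x∈p)) λ ()

  ∣inside++outside∣ : ∀ k n → ∣ replicate k inside ++ replicate n outside ∣ ≡ k
  ∣inside++outside∣ zero    n = ∣⊥∣≡0 n
  ∣inside++outside∣ (suc k) n = cong suc (∣inside++outside∣ k n)

  ∣outside++p∣ : ∀ a {n} (p : Subset n) → ∣ replicate a outside ++ p ∣ ≡ ∣ p ∣
  ∣outside++p∣ zero    p = refl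
  ∣outside++p∣ (suc a) p = ∣outside++p∣ a p

  ∣p++outside∣ : ∀ {n} (p : Subset n) m → ∣ p ++ replicate m outside ∣ ≡ ∣ p ∣
  ∣p++outside∣ []            m = ∣⊥∣≡0 m
  ∣p++outside∣ (outside ∷ p) m = ∣p++outside∣ p m
  ∣p++outside∣ (inside  ∷ p) m = cong suc (∣p++outside∣ p m)

  -- `Q` consists of the first `k` clique vertices and the hubs are the other `s`. The summand 0 in
  -- `c ℕ.+ 0` comes from the empty join that ends the list.
  K∨K₁-obstruction : ∀ k s c → Obstruction (⋁ (K (k ℕ.+ s) ∷ (c K₁) ∷ [])) k s c
  K∨K₁-obstruction k s c = record
    { Q         = block ++ replicate (c ℕ.+ 0) outside
    ; ∣Q∣≡k     = trans (∣p++outside∣ block (c ℕ.+ 0)) (∣inside++outside∣ k s)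
    ; leaf      = λ i → (k ℕ.+ s) ↑ʳ (i ↑ˡ 0)
    ; leaf-inj  = λ {i} {j} eq → Fin.↑ˡ-injective 0 i j (Fin.↑ʳ-injective (k ℕ.+ s) (i ↑ˡ 0) (j ↑ˡ 0) eq)
    ; leaf∉Q    = λ i → outside⇒∈∁ (block ++ replicate (c ℕ.+ 0) outside) _
        (trans (lookup-++ʳ block (replicate (c ℕ.+ 0) outside) (i ↑ˡ 0)) (lookup-replicate (i ↑ˡ 0) outside))
    ; hub       = λ j → (k ↑ʳ j) ↑ˡ (c ℕ.+ 0)
    ; neighbour = λ i w w∈∁Q → lemma i w (∈∁⇒outside w∈∁Q)
    }
    where
    block : Subset (k ℕ.+ s)
    block = replicate k inside ++ replicate s outside

    in-block : ∀ (u : Fin (k ℕ.+ s)) → lookup block u ≡ outside → ∃[ j ] u ≡ k ↑ʳ j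
    in-block u eq with splitAt k u in split
    ... | inj₂ j = j , sym (Fin.splitAt⁻¹-↑ʳ split)
    ... | inj₁ j = contradiction (trans (sym eq) (trans (cong (lookup block) (sym (Fin.splitAt⁻¹-↑ˡ split)))
      (trans (lookup-++ˡ (replicate k inside) (replicate s outside) j) (lookup-replicate j inside)))) λ ()

    lemma : ∀ (i : Fin c) w → lookup (block ++ replicate (c ℕ.+ 0) outside) w ≡ outside →
      adj (⋁ (K (k ℕ.+ s) ∷ (c K₁) ∷ [])) ((k ℕ.+ s) ↑ʳ (i ↑ˡ 0)) w ≡ true →
      ∃[ j ] w ≡ (k ↑ʳ j) ↑ˡ (c ℕ.+ 0)
    lemma i w out edge rewrite Fin.splitAt-↑ʳ (k ℕ.+ s) (c ℕ.+ 0) (i ↑ˡ 0) with splitAt (k ℕ.+ s) w in split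
    ... | inj₁ u = let j , u≡ = in-block u (trans (sym (lookup-++ˡ block (replicate (c ℕ.+ 0) outside) u))
                         (trans (cong (lookup (block ++ replicate (c ℕ.+ 0) outside)) (Fin.splitAt⁻¹-↑ˡ split)) out)) in
      j , trans (sym (Fin.splitAt⁻¹-↑ˡ split)) (cong (_↑ˡ (c ℕ.+ 0)) u≡)
    ... | inj₂ z rewrite Fin.splitAt-↑ˡ c i 0 with splitAt c z
    ... | inj₁ _ = contradiction edge λ ()
    ... | inj₂ ()

  -- The new clique is joined only to `G`. Leaves outside `G` therefore gain no neighbours, and the
  -- old obstruction survives with its vertices shifted by `a`.
  K∨-obstruction : ∀ a {b ns} (G : Graph (Fin b)) (Gs : All (Graph ∘ Fin) ns) {k s c} (O : Obstruction (⋁ (G ∷ Gs)) k s c) →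
    (∀ i → inFirst (b ∷ ns) (leaf O i) ≡ false) → Obstruction (⋁ (K a ∷ G ∷ Gs)) k s c
  K∨-obstruction a {b} {ns} G Gs O leaf∉first = record
    { Q         = replicate a outside ++ Q O
    ; ∣Q∣≡k     = trans (∣outside++p∣ a (Q O)) (∣Q∣≡k O)
    ; leaf      = λ i → a ↑ʳ leaf O i
    ; leaf-inj  = λ {i} {j} eq → leaf-inj O (Fin.↑ʳ-injective a (leaf O i) (leaf O j) eq)
    ; leaf∉Q    = λ i → outside⇒∈∁ (replicate a outside ++ Q O) _
        (trans (lookup-++ʳ (replicate a outside) (Q O) (leaf O i)) (∈∁⇒outside (leaf∉Q O i)))
    ; hub       = λ j → a ↑ʳ hub O j
    ; neighbour = λ i w w∈∁Q → lemma i w (∈∁⇒outside w∈∁Q)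
    }
    where
    lemma : ∀ i w → lookup (replicate a outside ++ Q O) w ≡ outside →
      adj (⋁ (K a ∷ G ∷ Gs)) (a ↑ʳ leaf O i) w ≡ true → ∃[ j ] w ≡ a ↑ʳ hub O j
    lemma i w out edge rewrite Fin.splitAt-↑ʳ a (b ℕ.+ sumℕ ns) (leaf O i) with splitAt a w in split
    ... | inj₁ u = contradiction (trans (sym edge) (leaf∉first i)) λ ()
    ... | inj₂ z = let j , z≡ = neighbour O i z (outside⇒∈∁ (Q O) z (trans (sym (lookup-++ʳ (replicate a outside) (Q O) z))
                         (trans (cong (lookup (replicate a outside ++ Q O)) (Fin.splitAt⁻¹-↑ʳ split)) out))) edge in
      j , trans (sym (Fin.splitAt⁻¹-↑ʳ split)) (cong (a ↑ʳ_) z≡)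

  K∨K₁-¬factorCritical : ∀ k {s c} → s ℕ.< c → ¬ IsFactorCritical k (⋁ (K (k ℕ.+ s) ∷ (c K₁) ∷ []))
  K∨K₁-¬factorCritical k {s} {c} s<c = obstruction⇒¬factorCritical s<c (K∨K₁-obstruction k s c)

  K∨K∨K₁-¬factorCritical : ∀ a k {s c} → s ℕ.< c → ¬ IsFactorCritical k (⋁ (K a ∷ K (k ℕ.+ s) ∷ (c K₁) ∷ []))
  K∨K∨K₁-¬factorCritical a k {s} {c} s<c = obstruction⇒¬factorCritical s<c
    (K∨-obstruction a (K (k ℕ.+ s)) ((c K₁) ∷ []) (K∨K₁-obstruction k s c)
      λ i → cong [ (λ _ → true) , (λ _ → false) ]′ (Fin.splitAt-↑ʳ (k ℕ.+ s) (c ℕ.+ 0) (i ↑ˡ 0)))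

-- Spectral radii from positive eigenvectors

module SpectralRadius where

  open import Data.Vec.Functional using (_++_)
  open import Defs hiding (_+_; _*_; -_; _-_)
  open Reals
  open ℝS using (solve; _:=_; _:+_; _:*_; _:-_; con)

  𝟙 : Bool → ℝ
  𝟙 b = if b then 1ℝ else 0ℝ

  ∣𝟙∣ : ∀ b → ∣ 𝟙 b ∣ ≈ 𝟙 b
  ∣𝟙∣ true  = ∣1∣
  ∣𝟙∣ false = ∣0∣

  D-rows : ∀ {n} (A : Matrix n) (v : Fin n → ℝ) (i : Fin n) → ∑ (λ j → A i j D.* v j) ≈ sum (λ j → A i j * v j)
  D-rows A v i = ∑≈sum {f = λ j → A i j D.* v j} {g = λ j → A i j * v j} λ j → D*≈* (A i j) (v j)

  module _ {n} (G : Graph (Fin n)) where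

    module _ {w : Fin n → ℝ} {θ : ℝ} (0≺w : ∀ i → 0ℝ ≺ w i) (Aw≈θw : ∀ i → sum (λ j → adjacencyMatrix G i j * w j) ≈ θ * w i) where

      eigenvalue≼ : ∀ μ → IsEigenvalue (adjacencyMatrix G) μ → μ ≼ θ
      eigenvalue≼ μ (v , (k , vₖ#0) , Av≃μv) =
        -- The pairing to be cancelled is positive because its `k`-th summand is.
        *-cancelʳ-≼ (0≺sum (λ i → 0≼* (0≺w i) (0≼∣ v i ∣)) k (0≺* (0≺w k) (#0⇒0≺∣ v k ∣ vₖ#0))) (begin
          μ * sum (λ i → w i * ∣ v i ∣)
            ≈⟨ *-distribˡ-sum μ (λ i → w i * ∣ v i ∣) ⟩
          sum (λ i → μ * (w i * ∣ v i ∣))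
            ≈⟨ sum-cong (λ i → solve 3 (λ m w v → m :* (w :* v) := w :* (m :* v)) ≈-refl μ (w i) ∣ v i ∣) ⟩
          sum (λ i → w i * (μ * ∣ v i ∣))
            ≲⟨ sum-mono-≼ (λ i → *-monoˡ-≼ (0≺w i) (row i)) ⟩
          sum (λ i → w i * sum (λ j → adjacencyMatrix G i j * ∣ v j ∣))
            ≈⟨ sum-cong (λ i → *-distribˡ-sum (w i) (λ j → adjacencyMatrix G i j * ∣ v j ∣)) ⟩
          sum (λ i → sum λ j → w i * (adjacencyMatrix G i j * ∣ v j ∣))
            ≈⟨ ∑-comm (λ i j → w i * (adjacencyMatrix G i j * ∣ v j ∣)) ⟩
          sum (λ j → sum λ i → w i * (adjacencyMatrix G i j * ∣ v j ∣))
            ≈⟨ sum-cong column ⟩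
          sum (λ j → θ * (w j * ∣ v j ∣))
            ≈⟨ *-distribˡ-sum θ (λ i → w i * ∣ v i ∣) ⟨
          θ * sum (λ i → w i * ∣ v i ∣) ∎)
        where
        open PreorderReasoning ≼-preorder

        row : ∀ i → μ * ∣ v i ∣ ≼ sum (λ j → adjacencyMatrix G i j * ∣ v j ∣)
        row i = begin
          μ * ∣ v i ∣
            ≲⟨ x*∣y∣≼∣x*y∣ μ (v i) ⟩
          ∣ μ * v i ∣
            ≈⟨ ∣-∣-cong (≈-trans (≈-sym (D*≈* μ (v i))) (≈-trans (≈-sym ⟪ Av≃μv i ⟫) (D-rows (adjacencyMatrix G) v i))) ⟩
          ∣ sum (λ j → adjacencyMatrix G i j * v j) ∣
            ≲⟨ ∣sum∣≼sum∣∣ (λ j → adjacencyMatrix G i j * v j) ⟩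
          sum (λ j → ∣ adjacencyMatrix G i j * v j ∣)
            ≈⟨ sum-cong (λ j → ≈-trans (∣x*y∣≈∣x∣*∣y∣ (adjacencyMatrix G i j) (v j)) (*-congʳ (∣𝟙∣ (adj G i j)))) ⟩
          sum (λ j → adjacencyMatrix G i j * ∣ v j ∣) ∎

        -- Symmetry of the adjacency matrix moves it from ∣v∣ onto `w`, where the eigenvector
        -- equation applies.
        column : ∀ j → sum (λ i → w i * (adjacencyMatrix G i j * ∣ v j ∣)) ≈ θ * (w j * ∣ v j ∣)
        column j = begin-equality
          sum (λ i → w i * (adjacencyMatrix G i j * ∣ v j ∣))
            ≈⟨ sum-cong (λ i → ≈-trans
                 (solve 3 (λ w a v → w :* (a :* v) := (a :* w) :* v) ≈-refl (w i) (adjacencyMatrix G i j) ∣ v j ∣)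
                 (*-congʳ (*-congʳ (≡⇒≈ (cong 𝟙 (symm G i j)))))) ⟩
          sum (λ i → adjacencyMatrix G j i * w i * ∣ v j ∣)
            ≈⟨ *-distribʳ-sum ∣ v j ∣ (λ i → adjacencyMatrix G j i * w i) ⟨
          sum (λ i → adjacencyMatrix G j i * w i) * ∣ v j ∣
            ≈⟨ *-congʳ (Aw≈θw j) ⟩
          θ * w j * ∣ v j ∣
            ≈⟨ *-assoc θ (w j) ∣ v j ∣ ⟩
          θ * (w j * ∣ v j ∣) ∎

      -- The vertex supplies the entry of `w` apart from 0; a graph without vertices has no
      -- eigenvalue.
      positiveEigenvector⇒spectralRadius : Fin n → IsSpectralRadius G θ
      positiveEigenvector⇒spectralRadius k =
        (w , (k , inj₂ (≺⇒< {0ℝ} {w k} (0≺w k))) ,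
          λ i → ≈⇒≃ {∑ λ j → adjacencyMatrix G i j D.* w j} {θ D.* w i} (≈-trans (D-rows (adjacencyMatrix G) w i) (≈-trans (Aw≈θw i) (≈-sym (D*≈* θ (w i)))))) ,
        λ μ μ-eigenvalue → ≼⇒≤ {μ} {θ} (eigenvalue≼ μ μ-eigenvalue)

  -- Block-constant eigenvectors of sequential joins

  sum-splitAt : ∀ m {n} (f : Fin m ⊎ Fin n → ℝ) →
    sum (λ k → f (splitAt m k)) ≈ sum (λ i → f (inj₁ i)) + sum (λ j → f (inj₂ j))
  sum-splitAt zero    f = ≈-sym (+-identityˡ _)
  sum-splitAt (suc m) f = ≈-trans
    (+-congˡ (≈-trans (sum-cong λ k → ≡⇒≈ (lemma (splitAt m k))) (sum-splitAt m f′)))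
    (≈-sym (+-assoc (f (inj₁ zero)) (sum λ i → f (inj₁ (suc i))) (sum λ j → f (inj₂ j))))
    where
    f′ : Fin m ⊎ Fin _ → ℝ
    f′ = [ f ∘ inj₁ ∘ suc , f ∘ inj₂ ]′

    lemma : ∀ s → f (map₁ suc s) ≡ f′ s
    lemma (inj₁ _) = refl
    lemma (inj₂ _) = refl

  fromℤ-+ : ∀ y z → fromℤ (y ℤ.+ z) ≈ fromℤ y + fromℤ z
  fromℤ-+ y z = ≈-trans (pointwise-≈ {y = fromℚ (y ℚ./ 1 ℚ.+ z ℚ./ 1)} λ _ → /1-homo-+ y z) (fromℚ-+ (y ℚ./ 1) (z ℚ./ 1))

  fromℤ-* : ∀ y z → fromℤ (y ℤ.* z) ≈ fromℤ y * fromℤ z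
  fromℤ-* y z = ≈-trans (pointwise-≈ {y = fromℚ ((y ℚ./ 1) ℚ.* (z ℚ./ 1))} λ _ → /1-homo-* y z) (fromℚ-* (y ℚ./ 1) (z ℚ./ 1))

  fromℕ-suc : ∀ n → fromℕ (suc n) ≈ 1ℝ + fromℕ n
  fromℕ-suc n = fromℤ-+ (+ 1) (+ n)

  sum-const : ∀ n x → sum {n} (λ _ → x) ≈ fromℕ n * x
  sum-const zero    x = ≈-sym (zeroˡ x)
  sum-const (suc n) x = begin
    x + sum {n} (λ _ → x)  ≈⟨ +-congˡ (sum-const n x) ⟩
    x + fromℕ n * x        ≈⟨ solve 2 (λ n x → x :+ n :* x := (con 1ℚ :+ n) :* x) ≈-refl (fromℕ n) x ⟩
    (1ℝ + fromℕ n) * x     ≈⟨ *-congʳ (fromℕ-suc n) ⟨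
    fromℕ (suc n) * x      ∎
    where open SetoidReasoning setoid

  sum-K : ∀ {n} (i : Fin n) x → sum (λ j → adjacencyMatrix (K n) i j * x) ≈ (fromℕ n - 1ℝ) * x
  sum-K {suc n} zero x = begin
    0ℝ * x + sum {n} (λ _ → 1ℝ * x)  ≈⟨ +-congˡ (sum-const n (1ℝ * x)) ⟩
    0ℝ * x + fromℕ n * (1ℝ * x)      ≈⟨ solve 2 (λ n x → con 0ℚ :* x :+ n :* (con 1ℚ :* x) := (con 1ℚ :+ n :- con 1ℚ) :* x) ≈-refl (fromℕ n) x ⟩
    (1ℝ + fromℕ n - 1ℝ) * x          ≈⟨ *-congʳ (+-congʳ (fromℕ-suc n)) ⟨
    (fromℕ (suc n) - 1ℝ) * x         ∎
    where open SetoidReasoning setoid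
  sum-K {suc n} (suc i) x = begin
    1ℝ * x + sum (λ j → adjacencyMatrix (K n) i j * x)  ≈⟨ +-congˡ (sum-K i x) ⟩
    1ℝ * x + (fromℕ n - 1ℝ) * x                         ≈⟨ solve 2 (λ n x → con 1ℚ :* x :+ (n :- con 1ℚ) :* x := (con 1ℚ :+ n :- con 1ℚ) :* x) ≈-refl (fromℕ n) x ⟩
    (1ℝ + fromℕ n - 1ℝ) * x                             ≈⟨ *-congʳ (+-congʳ (fromℕ-suc n)) ⟨
    (fromℕ (suc n) - 1ℝ) * x                            ∎
    where open SetoidReasoning setoid

  sum-K₁ : ∀ n x → sum {n} (λ _ → 0ℝ * x) ≈ 0ℝ
  sum-K₁ n x = ≈-trans (sum-const n (0ℝ * x)) (≈-trans (*-congˡ (zeroˡ x)) (zeroʳ (fromℕ n)))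

  -- Eigenvector equations for v on ⋁ Gs when every vertex of the first graph also receives e from an earlier graph.
  Rows : ∀ {ns} → All (Graph ∘ Fin) ns → (Fin (sumℕ ns) → ℝ) → ℝ → ℝ → Set
  Rows {ns} Gs v x e = ∀ z → 𝟙 (inFirst ns z) * e + sum (λ j → adjacencyMatrix (⋁ Gs) z j * v j) ≈ x * v z

  -- The contribution of `v` to each vertex of the graph preceding the list.
  firstSum : ∀ ns → (Fin (sumℕ ns) → ℝ) → ℝ
  firstSum ns v = sum (λ j → 𝟙 (inFirst ns j) * v j)

  firstSum-∷ : ∀ m {ns} (u : Fin m → ℝ) (v : Fin (sumℕ ns) → ℝ) → firstSum (m ∷ ns) (u ++ v) ≈ sum u
  firstSum-∷ m {ns} u v = ≈-trans
    (sum-splitAt m (λ s → 𝟙 ([ const true , const false ]′ s) * [ u , v ]′ s))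
    -- The terms beyond the first block vanish; they are written as 0 · 0 to fit `sum-K₁`.
    (≈-trans (+-cong (sum-cong λ i → *-identityˡ (u i)) (sum-cong {g = λ _ → 0ℝ * 0ℝ} λ j → ≈-trans (zeroˡ (v j)) (≈-sym (zeroˡ 0ℝ))))
      (≈-trans (+-congˡ (sum-K₁ (sumℕ ns) 0ℝ)) (+-identityʳ (sum u))))

  -- A vertex of `G` receives `e` from before, its neighbours within `G`, and `firstSum` from after.
  -- For the remaining graphs `G` is the earlier graph and sends `sum u`, so the equations can be
  -- checked one block at a time.
  Rows-∷ : ∀ {m ns} (G : Graph (Fin m)) (Gs : All (Graph ∘ Fin) ns) (u : Fin m → ℝ) (v : Fin (sumℕ ns) → ℝ) {x e : ℝ} →
    (∀ i → e + (sum (λ j → adjacencyMatrix G i j * u j) + firstSum ns v) ≈ x * u i) →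
    Rows Gs v x (sum u) → Rows (G ∷ Gs) (u ++ v) x e
  Rows-∷ {m} {ns} G Gs u v {x} {e} first rest z = lemma (splitAt m z)
    where
    open SetoidReasoning setoid

    lemma : ∀ s → 𝟙 ([ const true , const false ]′ s) * e +
      sum (λ k → 𝟙 (adj (glue G (⋁ Gs) (inFirst ns)) s (splitAt m k)) * [ u , v ]′ (splitAt m k)) ≈ x * [ u , v ]′ s
    lemma (inj₁ i) = ≈-trans
      (+-cong (*-identityˡ e) (sum-splitAt m (λ s → 𝟙 (adj (glue G (⋁ Gs) (inFirst ns)) (inj₁ i) s) * [ u , v ]′ s)))
      (first i)
    lemma (inj₂ w) = begin
      0ℝ * e + sum (λ k → 𝟙 (adj (glue G (⋁ Gs) (inFirst ns)) (inj₂ w) (splitAt m k)) * [ u , v ]′ (splitAt m k))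
        ≈⟨ +-cong (zeroˡ e) (sum-splitAt m (λ s → 𝟙 (adj (glue G (⋁ Gs) (inFirst ns)) (inj₂ w) s) * [ u , v ]′ s)) ⟩
      0ℝ + (sum (λ i → 𝟙 (inFirst ns w) * u i) + sum (λ j → adjacencyMatrix (⋁ Gs) w j * v j))
        ≈⟨ +-identityˡ _ ⟩
      sum (λ i → 𝟙 (inFirst ns w) * u i) + sum (λ j → adjacencyMatrix (⋁ Gs) w j * v j)
        ≈⟨ +-congʳ (*-distribˡ-sum (𝟙 (inFirst ns w)) u) ⟨
      𝟙 (inFirst ns w) * sum u + sum (λ j → adjacencyMatrix (⋁ Gs) w j * v j)
        ≈⟨ rest w ⟩
      x * v w ∎

  Rows⇒eigen : ∀ {ns} (Gs : All (Graph ∘ Fin) ns) (v : Fin (sumℕ ns) → ℝ) x → Rows Gs v x 0ℝ →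
    ∀ i → sum (λ j → adjacencyMatrix (⋁ Gs) i j * v j) ≈ x * v i
  Rows⇒eigen {ns} Gs v x rows i = ≈-trans
    (≈-sym (≈-trans (+-congʳ (zeroʳ (𝟙 (inFirst ns i)))) (+-identityˡ _))) (rows i)

  ++⁺ : ∀ {m n} {P : ℝ → Set} {u : Fin m → ℝ} {v : Fin n → ℝ} → (∀ i → P (u i)) → (∀ j → P (v j)) → ∀ k → P ((u ++ v) k)
  ++⁺ {m} {P = P} {u} {v} Pu Pv k = lemma (splitAt m k)
    where
    lemma : ∀ s → P ([ u , v ]′ s)
    lemma (inj₁ i) = Pu i
    lemma (inj₂ j) = Pv j

  0≼fromℕ : ∀ n → 0ℝ ≼ fromℕ n
  0≼fromℕ n = pointwise-≼ λ _ → 0≤/1 n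

  0≺1 : 0ℝ ≺ 1ℝ
  0≺1 = ⟪ ½ , ℚ.positive⁻¹ ½ , 0 , (λ _ _ → from-yes (0ℚ ℚ.+ ½ ℚ.<? 1ℚ)) ⟫

  1≼fromℕ : ∀ {n} → 0 ℕ.< n → 1ℝ ≼ fromℕ n
  1≼fromℕ {suc n} _ = ≼-trans (≈⇒≼ (≈-sym (+-identityʳ 1ℝ)))
    (≼-trans (+-mono-≼ ≼-refl (0≼fromℕ n)) (≈⇒≼ (≈-sym (fromℕ-suc n))))

  0≺fromℕ : ∀ {n} → 0 ℕ.< n → 0ℝ ≺ fromℕ n
  0≺fromℕ 0<n = ≺-≼-trans 0≺1 (1≼fromℕ 0<n)

  x≼y⇒0≼y-x : ∀ {x y} → x ≼ y → 0ℝ ≼ y - x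
  x≼y⇒0≼y-x {x} x≼y = ≼-trans (≈⇒≼ (≈-sym (+-inverseʳ x))) (+-mono-≼ x≼y ≼-refl)

  -- Weights x on the clique and B on the isolated vertices satisfy the equation of an isolated
  -- vertex, Bx = xB, identically; `root` is the equation of a clique vertex.
  module _ (b c : ℕ) (x : ℝ)
    (root : x * x ≈ (fromℕ b - 1ℝ) * x + fromℕ c * fromℕ b) where

    private
      B C : ℝ
      B = fromℕ b
      C = fromℕ c

      leaves : Fin (c ℕ.+ 0) → ℝ
      leaves = _++_ {m = c} (λ _ → B) (λ ())

      weights : Fin (b ℕ.+ (c ℕ.+ 0)) → ℝ
      weights = _++_ {m = b} (λ _ → x) leaves

    K∨K₁-rows : Rows (K b ∷ (c K₁) ∷ []) weights x 0ℝ
    K∨K₁-rows = Rows-∷ (K b) ((c K₁) ∷ []) (λ _ → x) leaves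
      (λ i → begin
        0ℝ + (sum (λ j → adjacencyMatrix (K b) i j * x) + firstSum (c ∷ []) leaves)
          ≈⟨ +-identityˡ _ ⟩
        sum (λ j → adjacencyMatrix (K b) i j * x) + firstSum (c ∷ []) leaves
          ≈⟨ +-cong (sum-K i x) (≈-trans (firstSum-∷ c {[]} (λ _ → B) (λ ())) (sum-const c B)) ⟩
        (B - 1ℝ) * x + C * B
          ≈⟨ root ⟨
        x * x ∎)
      (Rows-∷ (c K₁) [] (λ _ → B) (λ ())
        (λ i → begin
          sum {b} (λ _ → x) + (sum {c} (λ _ → 0ℝ * B) + 0ℝ)
            ≈⟨ +-cong (sum-const b x) (+-congʳ (sum-K₁ c B)) ⟩
          B * x + (0ℝ + 0ℝ)
            ≈⟨ solve 2 (λ b x → b :* x :+ (con 0ℚ :+ con 0ℚ) := x :* b) ≈-refl B x ⟩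
          x * B ∎)
        (λ ()))
      where open SetoidReasoning setoid

    K∨K₁-spectralRadius : 0 ℕ.< b → Fin c → 0ℝ ≺ x → IsSpectralRadius (⋁ (K b ∷ (c K₁) ∷ [])) x
    K∨K₁-spectralRadius 0<b i 0≺x = positiveEigenvector⇒spectralRadius (⋁ (K b ∷ (c K₁) ∷ [])) {w = weights} {θ = x}
      (++⁺ {m = b} {P = 0ℝ ≺_} (λ _ → 0≺x) (++⁺ {m = c} {P = 0ℝ ≺_} (λ _ → 0≺fromℕ 0<b) (λ ())))
      (Rows⇒eigen (K b ∷ (c K₁) ∷ []) weights x K∨K₁-rows)
      (b ↑ʳ (i ↑ˡ 0))

  -- With t = x − (A − 1), the block values (B x, x t, B t) satisfy the first and last eigenvector
  -- equations identically; root is the middle one.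
  module _ (a b c : ℕ) (x : ℝ)
    (root : x * x * (x - (fromℕ a - 1ℝ)) ≈
      fromℕ a * (fromℕ b * x) + ((fromℕ b - 1ℝ) * (x * (x - (fromℕ a - 1ℝ))) + fromℕ c * (fromℕ b * (x - (fromℕ a - 1ℝ))))) where

    private
      A B C t : ℝ
      A = fromℕ a
      B = fromℕ b
      C = fromℕ c
      t = x - (A - 1ℝ)

      leaves : Fin (c ℕ.+ 0) → ℝ
      leaves = _++_ {m = c} (λ _ → B * t) (λ ())

      inner : Fin (b ℕ.+ (c ℕ.+ 0)) → ℝ
      inner = _++_ {m = b} (λ _ → x * t) leaves

      weights : Fin (a ℕ.+ (b ℕ.+ (c ℕ.+ 0))) → ℝ
      weights = _++_ {m = a} (λ _ → B * x) inner

    K∨K∨K₁-rows : Rows (K a ∷ K b ∷ (c K₁) ∷ []) weights x 0ℝ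
    K∨K∨K₁-rows = Rows-∷ (K a) (K b ∷ (c K₁) ∷ []) (λ _ → B * x) inner
      (λ i → begin
        0ℝ + (sum (λ j → adjacencyMatrix (K a) i j * (B * x)) + firstSum (b ∷ c ∷ []) inner)
          ≈⟨ +-congˡ (+-cong (sum-K i (B * x)) (≈-trans (firstSum-∷ b {c ∷ []} (λ _ → x * t) leaves) (sum-const b (x * t)))) ⟩
        0ℝ + ((A - 1ℝ) * (B * x) + B * (x * t))
          ≈⟨ solve 3 (λ a b x → con 0ℚ :+ ((a :- con 1ℚ) :* (b :* x) :+ b :* (x :* (x :- (a :- con 1ℚ)))) := x :* (b :* x)) ≈-refl A B x ⟩
        x * (B * x) ∎)
      (Rows-∷ (K b) ((c K₁) ∷ []) (λ _ → x * t) leaves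
        (λ i → begin
          sum {a} (λ _ → B * x) + (sum (λ j → adjacencyMatrix (K b) i j * (x * t)) + firstSum (c ∷ []) leaves)
            ≈⟨ +-cong (sum-const a (B * x)) (+-cong (sum-K i (x * t)) (≈-trans (firstSum-∷ c {[]} (λ _ → B * t) (λ ())) (sum-const c (B * t)))) ⟩
          A * (B * x) + ((B - 1ℝ) * (x * t) + C * (B * t))
            ≈⟨ root ⟨
          x * x * t
            ≈⟨ *-assoc x x t ⟩
          x * (x * t) ∎)
        (Rows-∷ (c K₁) [] (λ _ → B * t) (λ ())
          (λ i → begin
            sum {b} (λ _ → x * t) + (sum {c} (λ _ → 0ℝ * (B * t)) + 0ℝ)
              ≈⟨ +-cong (sum-const b (x * t)) (+-congʳ (sum-K₁ c (B * t))) ⟩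
            B * (x * t) + (0ℝ + 0ℝ)
              ≈⟨ solve 3 (λ b x t → b :* (x :* t) :+ (con 0ℚ :+ con 0ℚ) := x :* (b :* t)) ≈-refl B x t ⟩
            x * (B * t) ∎)
          (λ ())))
      where open SetoidReasoning setoid

    -- `A ≼ x` gives t = 1 + (x - A) > 0, which makes all three block values positive.
    K∨K∨K₁-spectralRadius : 0 ℕ.< a → 0 ℕ.< b → Fin c → A ≼ x → IsSpectralRadius (⋁ (K a ∷ K b ∷ (c K₁) ∷ [])) x
    K∨K∨K₁-spectralRadius 0<a 0<b i A≼x = positiveEigenvector⇒spectralRadius (⋁ (K a ∷ K b ∷ (c K₁) ∷ [])) {w = weights} {θ = x}
      (++⁺ {m = a} {P = 0ℝ ≺_} (λ _ → 0≺* 0≺B 0≺x)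
        (++⁺ {m = b} {P = 0ℝ ≺_} (λ _ → 0≺* 0≺x 0≺t)
          (++⁺ {m = c} {P = 0ℝ ≺_} (λ _ → 0≺* 0≺B 0≺t) (λ ()))))
      (Rows⇒eigen (K a ∷ K b ∷ (c K₁) ∷ []) weights x K∨K∨K₁-rows)
      (a ↑ʳ (b ↑ʳ (i ↑ˡ 0)))
      where
      0≺B : 0ℝ ≺ B
      0≺B = 0≺fromℕ 0<b
      0≺x : 0ℝ ≺ x
      0≺x = ≺-≼-trans (0≺fromℕ 0<a) A≼x
      0≺t : 0ℝ ≺ t
      0≺t = ≺-≼-trans (0≺+ 0≺1 (x≼y⇒0≼y-x A≼x))
        (≈⇒≼ (solve 2 (λ a x → con 1ℚ :+ (x :- a) := x :- (a :- con 1ℚ)) ≈-refl A x))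

  -- Square roots and the largest root of the cubic

  x-y≈0⇒x≈y : ∀ {x y} → x - y ≈ 0ℝ → x ≈ y
  x-y≈0⇒x≈y {x} {y} x-y≈0 = begin
    x            ≈⟨ solve 2 (λ x y → x := (x :- y) :+ y) ≈-refl x y ⟩
    (x - y) + y  ≈⟨ +-congʳ x-y≈0 ⟩
    0ℝ + y       ≈⟨ +-identityˡ y ⟩
    y            ∎
    where open SetoidReasoning setoid

  0≼y⇒0-y≼0 : ∀ {y} → 0ℝ ≼ y → 0ℝ - y ≼ 0ℝ
  0≼y⇒0-y≼0 {y} 0≼y = ≼-trans (≈⇒≼ (≈-sym (+-identityʳ _)))
    (≼-trans (+-mono-≼ ≼-refl 0≼y) (≈⇒≼ (solve 1 (λ y → con 0ℚ :- y :+ y := con 0ℚ) ≈-refl y)))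

  -- For d ≥ 1, d² - d = d(d - 1) ≥ 0, so the interval from 0 to d brackets the root.
  sqrt : ∀ d → 0 ℕ.< d → ∃[ s ] IsSqrt (fromℕ d) s
  sqrt d 0<d =
    let s , Fs≈0 , 0≼s = intermediateValue F (λ q → q ℚ.* q ℚ.+ ℚ.- ((+ d) ℚ./ 1)) (λ _ _ → refl) F-cong
          {0ℚ} {(+ d) ℚ./ 1} 0≼d F0≼0 0≼F[d]
    in s , ≼⇒≤ {0ℝ} {s} 0≼s , ≈⇒≃ {s D.* s} {fromℕ d} (root s Fs≈0)
    where
    0≼d : 0ℝ ≼ fromℕ d
    0≼d = 0≼fromℕ d

    F : ℝ → ℝ
    F x = x D.* x D.- fromℕ d

    F≈ : ∀ x → F x ≈ x * x - fromℕ d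
    F≈ x = ≈-trans (D-≈- (x D.* x) (fromℕ d)) (+-congʳ (D*≈* x x))

    F-cong : ∀ {x y} → x ≈ y → F x ≈ F y
    F-cong {x} {y} x≈y = ≈-trans (F≈ x) (≈-trans (+-congʳ (*-cong x≈y x≈y)) (≈-sym (F≈ y)))

    F0≼0 : F (fromℚ 0ℚ) ≼ 0ℝ
    F0≼0 = ≼-trans (≈⇒≼ (≈-trans (F≈ (fromℚ 0ℚ)) (solve 1 (λ d → con 0ℚ :* con 0ℚ :- d := con 0ℚ :- d) ≈-refl (fromℕ d)))) (0≼y⇒0-y≼0 0≼d)

    0≼F[d] : 0ℝ ≼ F (fromℚ ((+ d) ℚ./ 1))
    0≼F[d] = ≼-trans (0≼* (0≺fromℕ 0<d) (x≼y⇒0≼y-x (1≼fromℕ 0<d)))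
      (≈⇒≼ (≈-sym (≈-trans (F≈ (fromℚ ((+ d) ℚ./ 1))) (solve 1 (λ d → d :* d :- d := d :* (d :- con 1ℚ)) ≈-refl (fromℕ d)))))

    root : ∀ s → F s ≈ 0ℝ → s D.* s ≈ fromℕ d
    root s Fs≈0 = ≈-trans (D*≈* s s) (x-y≈0⇒x≈y {s * s} {fromℕ d} (≈-trans (≈-sym (F≈ s)) Fs≈0))

  cubic≈ : ∀ n k x → cubic n k x ≈
    x * x * x - fromℤ (+ n ℤ.- + 4) * (x * x) - fromℤ (+ n ℤ.+ + 2 ℤ.* + k ℤ.- + 1) * x + fromℤ (+ 2 ℤ.* (+ k ℤ.+ + 1) ℤ.* (+ n ℤ.- + k ℤ.- + 4))
  cubic≈ n k x = ≈-trans
    (pointwise-≈ {cubic n k x} {x ^ 3 D.- c₂ D.* x ^ 2 D.- c₁ D.* x D.+ c₀} λ _ → refl) (general c₂ c₁ c₀ (x ^ 2) (x ^ 3) x²≈ x³≈)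
    where
    c₂ c₁ c₀ : ℝ
    c₂ = fromℤ (+ n ℤ.- + 4)
    c₁ = fromℤ (+ n ℤ.+ + 2 ℤ.* + k ℤ.- + 1)
    c₀ = fromℤ (+ 2 ℤ.* (+ k ℤ.+ + 1) ℤ.* (+ n ℤ.- + k ℤ.- + 4))

    +-≈ : ∀ x y {x′ y′} → x ≈ x′ → y ≈ y′ → x D.+ y ≈ x′ + y′
    +-≈ x y p q = ≈-trans (D+≈+ x y) (+-cong p q)

    ∸-≈ : ∀ x y {x′ y′} → x ≈ x′ → y ≈ y′ → x D.- y ≈ x′ - y′
    ∸-≈ x y p q = ≈-trans (D-≈- x y) (+-cong p (-‿cong q))

    *-≈ : ∀ x y {x′ y′} → x ≈ x′ → y ≈ y′ → x D.* y ≈ x′ * y′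
    *-≈ x y p q = ≈-trans (D*≈* x y) (*-cong p q)

    x²≈ : x ^ 2 ≈ x * x
    x²≈ = ≈-trans (pointwise-≈ {x ^ 2} {x D.* x} λ n → cong (seq x n ℚ.*_) (ℚ.*-identityʳ (seq x n))) (D*≈* x x)

    cube : ∀ (q : ℝ) → q ≈ x * x → x D.* q ≈ x * x * x
    cube q q≈x² = ≈-trans (*-≈ x q ≈-refl q≈x²) (≈-sym (*-assoc x x x))

    x³≈ : x ^ 3 ≈ x * x * x
    x³≈ = ≈-trans (pointwise-≈ {x ^ 3} {x D.* (x ^ 2)} λ _ → refl)
      (cube (x ^ 2) x²≈)

    -- Coefficients and powers are variables here, so nothing behind `fromℤ` or `_^_` has to be
    -- unfolded.
    general : ∀ (c₂ c₁ c₀ q r : ℝ) → q ≈ x * x → r ≈ x * x * x →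
      r D.- c₂ D.* q D.- c₁ D.* x D.+ c₀ ≈ x * x * x - c₂ * (x * x) - c₁ * x + c₀
    general c₂ c₁ c₀ q r q≈x² r≈x³ = +-≈ (r D.- c₂ D.* q D.- c₁ D.* x) c₀
      (∸-≈ (r D.- c₂ D.* q) (c₁ D.* x)
        (∸-≈ r (c₂ D.* q) r≈x³ (*-≈ c₂ q ≈-refl q≈x²))
        (*-≈ c₁ x ≈-refl ≈-refl))
      ≈-refl

  cubic-cong : ∀ n k {x y} → x ≈ y → cubic n k x ≈ cubic n k y
  cubic-cong n k {x} {y} x≈y = ≈-trans (cubic≈ n k x) (≈-trans
    (+-congʳ (+-cong (+-cong (*-cong (*-cong x≈y x≈y) x≈y) (-‿cong (*-congˡ (*-cong x≈y x≈y)))) (-‿cong (*-congˡ x≈y))))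
    (≈-sym (cubic≈ n k y)))

  fromℤ-sub : ∀ y z → fromℤ (y ℤ.- z) ≈ fromℤ y - fromℤ z
  fromℤ-sub y z = ≈-trans (fromℤ-+ y (ℤ.- z))
    (+-congˡ (≈-trans (pointwise-≈ {y = fromℚ (ℚ.- (z ℚ./ 1))} λ _ → /1-homo-neg z) (fromℚ-neg (z ℚ./ 1))))

  -- In terms of the clique sizes A and B = k+1 the coefficients become n-4 = A+B-2, n+2k-1 = A+3B-1
  -- and 2(k+1)(n-k-4) = 2B(A-1).
  module _ (a k n : ℕ) (n≡a+b+2 : n ≡ a ℕ.+ (k ℕ.+ 1) ℕ.+ 2) where

    private
      A B : ℝ
      A = fromℕ a
      B = fromℕ (k ℕ.+ 1)

    fromℕ-n : fromℕ n ≈ A + B + fromℕ 2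
    fromℕ-n = ≈-trans (≡⇒≈ (cong fromℕ n≡a+b+2))
      (≈-trans (fromℤ-+ (+ (a ℕ.+ (k ℕ.+ 1))) (+ 2)) (+-congʳ (fromℤ-+ (+ a) (+ (k ℕ.+ 1)))))

    fromℕ-k : fromℕ k ≈ B - 1ℝ
    fromℕ-k = ≈-trans (solve 1 (λ k → k := k :+ con 1ℚ :- con 1ℚ) ≈-refl (fromℕ k)) (+-congʳ (≈-sym (fromℤ-+ (+ k) (+ 1))))

    cubic≈poly : ∀ x → cubic n k x ≈
      x * x * x - (A + B - fromℕ 2) * (x * x) - (A + B + B + B - 1ℝ) * x + fromℕ 2 * B * (A - 1ℝ)
    cubic≈poly x = ≈-trans (cubic≈ n k x)
      (+-cong (+-cong (+-congˡ (-‿cong (*-congʳ c₂≈))) (-‿cong (*-congʳ c₁≈))) c₀≈)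
      where
      open SetoidReasoning setoid

      c₂≈ : fromℤ (+ n ℤ.- + 4) ≈ A + B - fromℕ 2
      c₂≈ = begin
        fromℤ (+ n ℤ.- + 4)         ≈⟨ fromℤ-sub (+ n) (+ 4) ⟩
        fromℕ n - fromℕ 4           ≈⟨ +-congʳ fromℕ-n ⟩
        A + B + fromℕ 2 - fromℕ 4   ≈⟨ solve 2 (λ a b → a :+ b :+ con ((+ 2) ℚ./ 1) :- con ((+ 4) ℚ./ 1) := a :+ b :- con ((+ 2) ℚ./ 1)) ≈-refl A B ⟩
        A + B - fromℕ 2             ∎

      c₁≈ : fromℤ (+ n ℤ.+ + 2 ℤ.* + k ℤ.- + 1) ≈ A + B + B + B - 1ℝ
      c₁≈ = begin
        fromℤ (+ n ℤ.+ + 2 ℤ.* + k ℤ.- + 1)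
          ≈⟨ ≈-trans (fromℤ-sub (+ n ℤ.+ + 2 ℤ.* + k) (+ 1)) (+-congʳ (≈-trans (fromℤ-+ (+ n) (+ 2 ℤ.* + k))
               (+-cong fromℕ-n (≈-trans (fromℤ-* (+ 2) (+ k)) (*-congˡ fromℕ-k))))) ⟩
        A + B + fromℕ 2 + fromℕ 2 * (B - 1ℝ) - 1ℝ
          ≈⟨ solve 2 (λ a b → a :+ b :+ con ((+ 2) ℚ./ 1) :+ con ((+ 2) ℚ./ 1) :* (b :- con 1ℚ) :- con 1ℚ := a :+ b :+ b :+ b :- con 1ℚ) ≈-refl A B ⟩
        A + B + B + B - 1ℝ ∎

      c₀≈ : fromℤ (+ 2 ℤ.* (+ k ℤ.+ + 1) ℤ.* (+ n ℤ.- + k ℤ.- + 4)) ≈ fromℕ 2 * B * (A - 1ℝ)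
      c₀≈ = begin
        fromℤ (+ 2 ℤ.* (+ k ℤ.+ + 1) ℤ.* (+ n ℤ.- + k ℤ.- + 4))
          ≈⟨ fromℤ-* (+ 2 ℤ.* (+ k ℤ.+ + 1)) (+ n ℤ.- + k ℤ.- + 4) ⟩
        fromℤ (+ 2 ℤ.* (+ k ℤ.+ + 1)) * fromℤ (+ n ℤ.- + k ℤ.- + 4)
          ≈⟨ *-cong (fromℤ-* (+ 2) (+ k ℤ.+ + 1)) (≈-trans (fromℤ-sub (+ n ℤ.- + k) (+ 4))
               (+-congʳ (≈-trans (fromℤ-sub (+ n) (+ k)) (+-cong fromℕ-n (-‿cong fromℕ-k))))) ⟩
        fromℕ 2 * B * (A + B + fromℕ 2 - (B - 1ℝ) - fromℕ 4)
          ≈⟨ *-congˡ (solve 2 (λ a b → a :+ b :+ con ((+ 2) ℚ./ 1) :- (b :- con 1ℚ) :- con ((+ 4) ℚ./ 1) := a :- con 1ℚ) ≈-refl A B) ⟩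
        fromℕ 2 * B * (A - 1ℝ) ∎

    -- For c = 2, the two sides of the middle eigenvector equation differ by exactly the cubic.
    root⇒spectralRadius : 0 ℕ.< a → ∀ x → cubic n k x ≈ 0ℝ → A ≼ x →
      IsSpectralRadius (⋁ (K a ∷ K (k ℕ.+ 1) ∷ (2 K₁) ∷ [])) x
    root⇒spectralRadius 0<a x root = K∨K∨K₁-spectralRadius a (k ℕ.+ 1) 2 x
      (x-y≈0⇒x≈y (≈-trans
        (solve 3 (λ a b x → x :* x :* (x :- (a :- con 1ℚ)) :-
            (a :* (b :* x) :+ ((b :- con 1ℚ) :* (x :* (x :- (a :- con 1ℚ))) :+ con ((+ 2) ℚ./ 1) :* (b :* (x :- (a :- con 1ℚ)))))
          := x :* x :* x :- (a :+ b :- con ((+ 2) ℚ./ 1)) :* (x :* x) :- (a :+ b :+ b :+ b :- con 1ℚ) :* x :+ con ((+ 2) ℚ./ 1) :* b :* (a :- con 1ℚ))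
          ≈-refl A B x)
        (≈-trans (≈-sym (cubic≈poly x)) root)))
      0<a (ℕ.m≤n+m 1 k) zero

    cubic-root : 0 ℕ.< a → ∃[ θ ] (cubic n k θ ≈ 0ℝ × A ≼ θ)
    -- The rational version of `cubic` is read off at index 0 of its value on a constant sequence.
    cubic-root 0<a = intermediateValue (cubic n k) (λ q → seq (cubic n k (fromℚ q)) 0) (λ _ _ → refl) (cubic-cong n k)
      {(+ a) ℚ./ 1} {(+ n) ℚ./ 1} A≼N lower upper
      where
      0≺A : 0ℝ ≺ A
      0≺A = 0≺fromℕ 0<a
      0≺B : 0ℝ ≺ B
      0≺B = 0≺fromℕ (ℕ.m≤n+m 1 k)
      0≼B-1 : 0ℝ ≼ B - 1ℝ
      0≼B-1 = x≼y⇒0≼y-x (1≼fromℕ (ℕ.m≤n+m 1 k))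
      A≼N : fromℚ ((+ a) ℚ./ 1) ≼ fromℚ ((+ n) ℚ./ 1)
      A≼N = ≼-trans (≈⇒≼ (≈-sym (+-identityʳ A)))
        (≼-trans (+-mono-≼ ≼-refl (0≼+ (≺⇒≼ 0≺B) (0≼fromℕ 2)))
          (≈⇒≼ (≈-trans (≈-sym (+-assoc A B (fromℕ 2))) (≈-sym fromℕ-n))))
      -- At x = A the cubic equals -((A² + A)(B - 1) + 2B), and B ≥ 1.
      lower : cubic n k (fromℚ ((+ a) ℚ./ 1)) ≼ 0ℝ
      lower = ≼-trans
        (≈⇒≼ (≈-trans (cubic≈poly (fromℚ ((+ a) ℚ./ 1)))
          (solve 2 (λ a b → a :* a :* a :- (a :+ b :- con ((+ 2) ℚ./ 1)) :* (a :* a) :- (a :+ b :+ b :+ b :- con 1ℚ) :* a :+ con ((+ 2) ℚ./ 1) :* b :* (a :- con 1ℚ)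
            := con 0ℚ :- (a :* (a :* (b :- con 1ℚ) :+ (b :- con 1ℚ)) :+ (b :+ b))) ≈-refl A B)))
        (0≼y⇒0-y≼0 (0≼+ (0≼* 0≺A (0≼+ (0≼* 0≺A 0≼B-1) 0≼B-1)) (0≼+ (≺⇒≼ 0≺B) (≺⇒≼ 0≺B))))
      -- At x = n = A+B+2 the two leading terms combine to 4x², since x - (A+B-2) = 4; the whole
      -- value expands with nonnegative coefficients only.
      upper : 0ℝ ≼ cubic n k (fromℚ ((+ n) ℚ./ 1))
      upper = ≼-trans
        (0≼+ (0≼* 0≺A (0≼+ (0≼* 0≺B (0≼fromℕ 6)) (0≼+ (0≼* 0≺A (0≼fromℕ 3)) (0≼fromℕ 15))))
          (0≼+ (0≼* 0≺B (0≼+ (≺⇒≼ 0≺B) (0≼fromℕ 9))) (0≼fromℕ 18)))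
        (≈⇒≼ (≈-sym (≈-trans (cubic-cong n k {fromℚ ((+ n) ℚ./ 1)} {A + B + fromℕ 2} fromℕ-n) (≈-trans (cubic≈poly (A + B + fromℕ 2))
          (solve 2 (λ a b → let x = a :+ b :+ con ((+ 2) ℚ./ 1) in
              x :* x :* x :- (a :+ b :- con ((+ 2) ℚ./ 1)) :* (x :* x) :- (a :+ b :+ b :+ b :- con 1ℚ) :* x :+ con ((+ 2) ℚ./ 1) :* b :* (a :- con 1ℚ)
            := a :* (b :* con ((+ 6) ℚ./ 1) :+ (a :* con ((+ 3) ℚ./ 1) :+ con ((+ 15) ℚ./ 1))) :+ (b :* (b :+ con ((+ 9) ℚ./ 1)) :+ con ((+ 18) ℚ./ 1)))
            ≈-refl A B)))))

    largestRoot : 0 ℕ.< a → ∃[ θ ] IsLargestRoot n k θ × IsSpectralRadius (⋁ (K a ∷ K (k ℕ.+ 1) ∷ (2 K₁) ∷ [])) θ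
    largestRoot 0<a = fromRoot (cubic-root 0<a)
      where
      fromRoot : ∃[ θ ] (cubic n k θ ≈ 0ℝ × A ≼ θ) →
        ∃[ θ ] IsLargestRoot n k θ × IsSpectralRadius (⋁ (K a ∷ K (k ℕ.+ 1) ∷ (2 K₁) ∷ [])) θ
      fromRoot (θ , root , A≼θ) = θ , (≈⇒≃ {cubic n k θ} {0ℝ} root , greatest) , radius
        where
        radius : IsSpectralRadius (⋁ (K a ∷ K (k ℕ.+ 1) ∷ (2 K₁) ∷ [])) θ
        radius = root⇒spectralRadius 0<a θ root A≼θ

        greatest : ∀ y → cubic n k y ≃ 0ℝ → y ≤ θ
        -- Assuming θ ≺ y yields A ≼ y, the condition under which a root is an eigenvalue;
        -- maximality of θ among eigenvalues then gives y ≼ θ, a contradiction.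
        greatest y y-root = ≼⇒≤ {y} {θ} (≮⇒≼ λ θ≺y →
          ≺-irrefl (≺-≼-trans θ≺y ⟪ proj₂ radius y (proj₁ (root⇒spectralRadius 0<a y ⟪ y-root ⟫ (≼-trans A≼θ (≺⇒≼ θ≺y)))) ⟫))

  -- Spectral radii given by a quadratic

  fromℕ-* : ∀ m n → fromℕ (m ℕ.* n) ≈ fromℕ m * fromℕ n
  fromℕ-* m n = ≈-trans (≡⇒≈ (cong fromℤ (ℤ.pos-* m n))) (fromℤ-* (+ m) (+ n))

  -- `d` is the discriminant of x² - mx - cb with m = b - 1, and the radius is its larger root.
  quadraticRadius : ∀ b c m d → b ≡ m ℕ.+ 1 → d ≡ m ℕ.* m ℕ.+ 4 ℕ.* (c ℕ.* b) → 0 ℕ.< m → 0 ℕ.< d → Fin c →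
    ∃[ s ] IsSqrt (fromℕ d) s × IsSpectralRadius (⋁ (K b ∷ (c K₁) ∷ [])) (fromℚ ½ D.* (fromℕ m D.+ s))
  quadraticRadius b c m d b≡m+1 d≡ 0<m 0<d i = fromSqrt (sqrt d 0<d)
    where
    open SetoidReasoning setoid

    B C M : ℝ
    B = fromℕ b
    C = fromℕ c
    M = fromℕ m

    d≈ : fromℕ d ≈ M * M + fromℕ 4 * (C * B)
    d≈ = ≈-trans (≡⇒≈ (cong fromℕ d≡)) (≈-trans (fromℤ-+ (+ (m ℕ.* m)) (+ (4 ℕ.* (c ℕ.* b))))
      (+-cong (fromℕ-* m m) (≈-trans (fromℕ-* 4 (c ℕ.* b)) (*-congˡ (fromℕ-* c b)))))

    M≈ : M ≈ B - 1ℝ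
    M≈ = ≈-trans (solve 1 (λ m → m := m :+ con 1ℚ :- con 1ℚ) ≈-refl M)
      (+-congʳ (≈-sym (≈-trans (≡⇒≈ (cong fromℕ b≡m+1)) (fromℤ-+ (+ m) (+ 1)))))

    module _ (s : ℝ) (0≼s : 0ℝ ≼ s) (s²≈d : s * s ≈ fromℕ d) (x : ℝ) (x≈ : x ≈ fromℚ ½ * (M + s)) where

      0≺x : 0ℝ ≺ x
      0≺x = ≺-≼-trans (0≺* (⟪ ½ ℚ.* ½ , ℚ.positive⁻¹ (½ ℚ.* ½) , 0 , (λ _ _ → from-yes (0ℚ ℚ.+ ½ ℚ.* ½ ℚ.<? ½)) ⟫) (0≺+ (0≺fromℕ 0<m) 0≼s)) (≈⇒≼ (≈-sym x≈))

      root : x * x ≈ (B - 1ℝ) * x + C * B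
      root = begin
        x * x
          ≈⟨ *-cong x≈ x≈ ⟩
        fromℚ ½ * (M + s) * (fromℚ ½ * (M + s))
          ≈⟨ solve 2 (λ m s → con ½ :* (m :+ s) :* (con ½ :* (m :+ s)) := m :* (con ½ :* (m :+ s)) :+ con (½ ℚ.* ½) :* (s :* s :- m :* m)) ≈-refl M s ⟩
        M * (fromℚ ½ * (M + s)) + fromℚ (½ ℚ.* ½) * (s * s - M * M)
          ≈⟨ +-cong (*-cong M≈ (≈-sym x≈)) (*-congˡ (+-congʳ (≈-trans s²≈d d≈))) ⟩
        (B - 1ℝ) * x + fromℚ (½ ℚ.* ½) * (M * M + fromℕ 4 * (C * B) - M * M)
          ≈⟨ +-congˡ (solve 3 (λ m c b → con (½ ℚ.* ½) :* (m :* m :+ con ((+ 4) ℚ./ 1) :* (c :* b) :- m :* m) := c :* b) ≈-refl M C B) ⟩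
        (B - 1ℝ) * x + C * B ∎

      radius : IsSpectralRadius (⋁ (K b ∷ (c K₁) ∷ [])) x
      radius = K∨K₁-spectralRadius b c x root (subst (0 ℕ.<_) (sym b≡m+1) (ℕ.m≤n+m 1 m)) i 0≺x

    fromSqrt : ∃[ s ] IsSqrt (fromℕ d) s →
      ∃[ s ] IsSqrt (fromℕ d) s × IsSpectralRadius (⋁ (K b ∷ (c K₁) ∷ [])) (fromℚ ½ D.* (fromℕ m D.+ s))
    fromSqrt (s , 0≤s , s²≃d) = s , (0≤s , s²≃d) ,
      radius s ⟪ 0≤s ⟫ (≈-trans (≈-sym (D*≈* s s)) ⟪ s²≃d ⟫) (fromℚ ½ D.* (fromℕ m D.+ s))
        (≈-trans (D*≈* (fromℚ ½) (fromℕ m D.+ s)) (*-congˡ (D+≈+ (fromℕ m) s)))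

  4K₁-discriminant : ∀ k → k ℕ.^ 2 ℕ.+ 18 ℕ.* k ℕ.+ 33 ≡ (k ℕ.+ 1) ℕ.* (k ℕ.+ 1) ℕ.+ 4 ℕ.* (4 ℕ.* (k ℕ.+ 2))
  4K₁-discriminant = ℕS.solve 1 (λ k → k ℕS.:^ 2 ℕS.:+ ℕS.con 18 ℕS.:* k ℕS.:+ ℕS.con 33 ℕS.:=
    (k ℕS.:+ ℕS.con 1) ℕS.:* (k ℕS.:+ ℕS.con 1) ℕS.:+ ℕS.con 4 ℕS.:* (ℕS.con 4 ℕS.:* (k ℕS.:+ ℕS.con 2))) refl

  5K₁-discriminant : ∀ k → k ℕ.^ 2 ℕ.+ 24 ℕ.* k ℕ.+ 64 ≡ (k ℕ.+ 2) ℕ.* (k ℕ.+ 2) ℕ.+ 4 ℕ.* (5 ℕ.* (k ℕ.+ 3))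
  5K₁-discriminant = ℕS.solve 1 (λ k → k ℕS.:^ 2 ℕS.:+ ℕS.con 24 ℕS.:* k ℕS.:+ ℕS.con 64 ℕS.:=
    (k ℕS.:+ ℕS.con 2) ℕS.:* (k ℕS.:+ ℕS.con 2) ℕS.:+ ℕS.con 4 ℕS.:* (ℕS.con 5 ℕS.:* (k ℕS.:+ ℕS.con 3))) refl

-- The three families of graphs

open import Defs
open FactorCriticality using (K∨K₁-¬factorCritical; K∨K∨K₁-¬factorCritical)
open SpectralRadius using (largestRoot; quadraticRadius; 4K₁-discriminant; 5K₁-discriminant)

theorem4p1 : (k n : ℕ) → n % 2 ≡ k % 2 →
    ( (k ℕ.+ 4 ℕ.≤ n × n ≢ k ℕ.+ 6 × n ≢ k ℕ.+ 8) ⊎ (k ≡ 0 × n ≡ 8) →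
    let G = ⋁ (K (n ∸ k ∸ 3) ∷ K (k ℕ.+ 1) ∷ (2 K₁) ∷ []) in
    (∃[ θ ] IsLargestRoot n k θ × IsSpectralRadius G θ)
    × ¬ IsFactorCritical k G )
    × ( n ≡ k ℕ.+ 6 →
    let G = ⋁ (K (k ℕ.+ 2) ∷ (4 K₁) ∷ []) in
    (∃[ s ] IsSqrt (fromℕ (k ℕ.^ 2 ℕ.+ 18 ℕ.* k ℕ.+ 33)) s
    × IsSpectralRadius G (fromℚ ½ * (fromℕ (k ℕ.+ 1) + s)))
    × ¬ IsFactorCritical k G )
    × ( n ≡ k ℕ.+ 8 →
    let G = ⋁ (K (k ℕ.+ 3) ∷ (5 K₁) ∷ []) in
    (∃[ s ] IsSqrt (fromℕ (k ℕ.^ 2 ℕ.+ 24 ℕ.* k ℕ.+ 64)) s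
    × IsSpectralRadius G (fromℚ ½ * (fromℕ (k ℕ.+ 2) + s)))
    × ¬ IsFactorCritical k G )
theorem4p1 k n _ =
  (λ h → largestRoot (n ∸ k ∸ 3) k n (order (k+4≤n h)) (size (k+4≤n h)) ,
    -- Deleting k of the k+1 middle vertices leaves one hub for two isolated vertices; the other two
    -- cases leave 2 hubs for 4 and 3 hubs for 5.
    K∨K∨K₁-¬factorCritical (n ∸ k ∸ 3) k {1} {2} ℕ.≤-refl) ,
  (λ _ → quadraticRadius (k ℕ.+ 2) 4 (k ℕ.+ 1) (k ℕ.^ 2 ℕ.+ 18 ℕ.* k ℕ.+ 33)
      (sym (ℕ.+-assoc k 1 1)) (4K₁-discriminant k) (ℕ.m≤n+m 1 k) (ℕ.m≤n⇒m≤o+n (k ℕ.^ 2 ℕ.+ 18 ℕ.* k) (ℕ.m≤m+n 1 32)) zero ,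
    K∨K₁-¬factorCritical k {2} {4} (ℕ.m≤m+n 3 1)) ,
  (λ _ → quadraticRadius (k ℕ.+ 3) 5 (k ℕ.+ 2) (k ℕ.^ 2 ℕ.+ 24 ℕ.* k ℕ.+ 64)
      (sym (ℕ.+-assoc k 2 1)) (5K₁-discriminant k) (ℕ.m≤n⇒m≤o+n k (ℕ.m≤m+n 1 1)) (ℕ.m≤n⇒m≤o+n (k ℕ.^ 2 ℕ.+ 24 ℕ.* k) (ℕ.m≤m+n 1 63)) zero ,
    K∨K₁-¬factorCritical k {3} {5} (ℕ.m≤m+n 4 1))
  where
  -- The pair (0, 8) satisfies this bound as well. The bound makes the truncated subtraction n ∸ k ∸
  -- 3 exact and the first clique nonempty.
  k+4≤n : (k ℕ.+ 4 ℕ.≤ n × n ≢ k ℕ.+ 6 × n ≢ k ℕ.+ 8) ⊎ (k ≡ 0 × n ≡ 8) → k ℕ.+ 4 ℕ.≤ n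
  k+4≤n (inj₁ (h , _))     = h
  k+4≤n (inj₂ (k≡0 , n≡8)) = subst₂ (λ k n → k ℕ.+ 4 ℕ.≤ n) (sym k≡0) (sym n≡8) (ℕ.m≤m+n 4 4)

  n∸k∸3 : n ∸ k ∸ 3 ≡ n ∸ (k ℕ.+ 3)
  n∸k∸3 = ℕ.∸-+-assoc n k 3

  size : k ℕ.+ 4 ℕ.≤ n → 0 ℕ.< n ∸ k ∸ 3
  size h = subst (0 ℕ.<_) (sym n∸k∸3) (ℕ.m<n⇒0<n∸m (ℕ.≤-trans (ℕ.≤-reflexive (sym (ℕ.+-suc k 3))) h))

  order : k ℕ.+ 4 ℕ.≤ n → n ≡ n ∸ k ∸ 3 ℕ.+ (k ℕ.+ 1) ℕ.+ 2
  order h = trans (sym (ℕ.m∸n+n≡m (ℕ.≤-trans (ℕ.+-monoʳ-≤ k (ℕ.m≤m+n 3 1)) h)))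
    (trans (cong (ℕ._+ (k ℕ.+ 3)) (sym n∸k∸3))
      (ℕS.solve 2 (λ a k → a ℕS.:+ (k ℕS.:+ ℕS.con 3) ℕS.:= a ℕS.:+ (k ℕS.:+ ℕS.con 1) ℕS.:+ ℕS.con 2) refl (n ∸ k ∸ 3) k))
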